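{- Let $(W,S)$ be a Coxeter system, with $W$ partially ordered by the Bruhat order $\leq_{\mathsf B}$. Let $F\in\mathrm{Mac}(W)$ and $u\in W$. Then $\nabla(\pi_u(F))\in\mathrm{Mac}(W)$. Moreover, for every subset $Y\subseteq W$, we have $\nabla(\pi_u(\nabla(Y)))=\nabla(\pi_u(Y))$.
   Context: For a poset $P$ and $X\subseteq P$, let $\mathrm{U}(X)=\{p\in P: p\geq x\text{ for all }x\in X\}$ and $\mathrm{L}(X)=\{p\in P: p\leq x\text{ for all }x\in X\}$. An order filter of $P$ is a subset $F$ with $x\le y$, $x\in F\Rightarrow y\in F$. The MacNeille completion $\mathrm{Mac}(P)$ is the set of order filters $F$ of $P$ with $F=\mathrm{U}(\mathrm{L}(F))$. For $w\in W$, $\ell(w)$ is the Coxeter length and $\mathrm{Des}(w)=\{s\in S:\ell(sw)<\ell(w)\}$ is the set of left descents. For $s\in S$, define $\pi_s\colon W\to W$ by $\pi_s(w)=sw$ if $s\in\mathrm{Des}(w)$ and $\pi_s(w)=w$ otherwise. For $u\in W$, let $\pi_u=\pi_{s_1}\cdots\pi_{s_k}$ where $s_1\cdots s_k$ is any reduced word for $u$ (this is well defined; $\pi_e$ is the identity). For $X\subseteq W$, $\pi_u(X)=\{\pi_u(x):x\in X\}$ and $\nabla(X)=\{w\in W: x\leq_{\mathsf B} w\text{ for some }x\in X\}$. Here $\mathrm{Mac}(W)$ is taken with respect to the Bruhat order. -}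

module Defs where

open import Data.Nat using (ℕ; zero; suc; _≤_; _<_)
open import Data.List using (List; []; _∷_; _++_; length; reverse)
open import Data.Maybe using (Maybe; just)
open import Data.Product using (Σ; ∃; _×_; _,_)
open import Data.Sum using (_⊎_)
open import Relation.Nullary using (¬_)
open import Relation.Binary.PropositionalEquality using (_≡_; _≢_)

-- A Coxeter matrix on an (arbitrary) generating type S.
-- m s t = just k means m(s,t) = k ; m s t = nothing means m(s,t) = ∞.
record CoxeterMatrix : Set₁ where
  field
    S       : Set
    m       : S → S → Maybe ℕ
    diag    : ∀ s → m s s ≡ just 1
    sym     : ∀ s t → m s t ≡ m t s
    offdiag : ∀ s t → s ≢ t → ∀ k → m s t ≡ just k → 2 ≤ k

-- The Coxeter system (W,S) presented by the Coxeter matrix: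
-- W = words in S modulo the congruence generated by (st)^{m(s,t)} = e
-- (with m(s,s) = 1 this includes s s = e, so this monoid presentation
-- is the group presentation).  Elements of W are represented by words,
-- equality in W is the setoid relation _≈_.
module Coxeter (C : CoxeterMatrix) where
  open CoxeterMatrix C

  Word : Set
  Word = List S

  alt : S → S → ℕ → Word
  alt s t zero    = []
  alt s t (suc k) = s ∷ t ∷ alt s t k

  infix 4 _≈_
  data _≈_ : Word → Word → Set where
    rel   : ∀ {s t k} → m s t ≡ just k → (a b : Word) →
            (a ++ alt s t k ++ b) ≈ (a ++ b)
    refl  : ∀ {x} → x ≈ x
    symm  : ∀ {x y} → x ≈ y → y ≈ x
    trans : ∀ {x y z} → x ≈ y → y ≈ z → x ≈ z

  -- ℓ(u) < ℓ(w), unfolding ℓ(w) = min { |b| : b a word for w }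
  LenLt : Word → Word → Set
  LenLt u w = Σ Word λ a → a ≈ u × (∀ b → b ≈ w → length a < length b)

  Reduced : Word → Set
  Reduced r = ∀ b → b ≈ r → length r ≤ length b

  -- reflections T = { v s v⁻¹ } ; the inverse of a word is its reverse
  IsReflection : Word → Set
  IsReflection t = Σ Word λ v → Σ S λ s → t ≈ (v ++ s ∷ reverse v)

  infix 4 _≤B_
  data _≤B_ : Word → Word → Set where
    ≤B-eq    : ∀ {x y} → x ≈ y → x ≤B y
    ≤B-step  : ∀ {x y} → (t : Word) → IsReflection t → y ≈ (x ++ t) →
               LenLt x y → x ≤B y
    ≤B-trans : ∀ {x y z} → x ≤B y → y ≤B z → x ≤B z

  -- Subsets of W : predicates on words respecting _≈_
  Subset : Set₁
  Subset = Word → Set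

  RespectsW : Subset → Set
  RespectsW X = ∀ {x y} → x ≈ y → X x → X y

  _⊆_ : Subset → Subset → Set
  X ⊆ Y = ∀ w → X w → Y w

  _≐_ : Subset → Subset → Set
  X ≐ Y = (X ⊆ Y) × (Y ⊆ X)

  U : Subset → Subset
  U X p = ∀ x → X x → x ≤B p

  L : Subset → Subset
  L X p = ∀ x → X x → p ≤B x

  OrderFilter : Subset → Set
  OrderFilter F = ∀ x y → x ≤B y → F x → F y

  InMac : Subset → Set
  InMac F = OrderFilter F × (F ≐ U (L F))

  ∇ : Subset → Subset
  ∇ X w = Σ Word λ x → X x × x ≤B w

  Des : S → Word → Set
  Des s w = LenLt (s ∷ w) w

  -- graph of π_s : π_s(w) = s w if s ∈ Des(w), w otherwise
  PiS : S → Word → Word → Set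
  PiS s w v = (Des s w × v ≈ (s ∷ w)) ⊎ (¬ Des s w × v ≈ w)

  PiWord : Word → Word → Word → Set
  PiWord []      x v = v ≈ x
  PiWord (s ∷ r) x v = Σ Word λ y → PiWord r x y × PiS s y v

  π : Word → Subset → Subset
  π u X v = Σ Word λ r → Reduced r × r ≈ u × Σ Word λ x → X x × PiWord r x v

module Submission where

-- For a generator s let π_s w and τ_s w be the smaller and the larger one of w and sw.  The
-- lifting property makes both monotone, and π_s is left adjoint to τ_s; composing, for a
-- reduced word r of u, π_r x ≤ p iff x ≤ τ_r p with τ_r the reversed composite of the τ_s.
-- Monotonicity gives the second assertion.  For the first, let p be above every lower bound
-- of ∇ (π_u F).  If q is a lower bound of F, then π_r q is one of ∇ (π_u F), so π_r q ≤ p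
-- and q ≤ τ_r p.  Hence τ_r p ∈ U (L F) = F, and π_r (τ_r p) ≤ p.  That π_r depends only on
-- u follows from π_r x = min { v x : v a subword of r } and the subword property.
--
-- All this needs descents to be decidable although _≡_ on S need not be.  Equality of
-- generators in W can be read off from m s t = 1; descents of a reduced word are then
-- decided by recursion on its length, since w has the distinct left descents s and t iff
-- m s t < ∞ and w begins with an alternating word of length m s t.  This rests on st having
-- order exactly m s t, which is seen in an integral variant of the geometric representation,
-- and on the exchange condition, where the reflections of a word are compared in the free
-- 𝔽₂-module by explicit cancelling pairs instead of by counting.

open import Defs
open import Level using (0ℓ)
open import Algebra.Bundles using (Group; module AbelianGroup)
import Algebra.Properties.Group as GroupProperties
open import Data.Bool using (Bool; true; false; not; _xor_)
import Data.Bool.Properties as Boolₚ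
open import Data.Integer as ℤ using (ℤ; +_; 0ℤ; 1ℤ)
import Data.Integer.Properties as ℤₚ
open import Data.Integer.Tactic.RingSolver using (solve-∀)
open import Data.List using (List; []; _∷_; _++_; length; reverse; map; applyUpTo; [_])
import Data.List.Membership.Setoid as MembershipSetoid
import Data.List.Properties as Listₚ
import Data.List.Relation.Binary.Permutation.Setoid as PermutationSetoid
import Data.List.Relation.Binary.Permutation.Setoid.Properties as PermutationSetoidProperties
open import Data.List.Relation.Binary.Pointwise using (Pointwise; []; _∷_)
open import Data.List.Relation.Binary.Sublist.Propositional using ([]; _∷_; _∷ʳ_; ⊆-refl; ⊆-trans) renaming (_⊆_ to _⊑_)
open import Data.List.Relation.Unary.Any as Any using (here; there)
import Data.List.Relation.Unary.Any.Properties as Anyₚ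
open import Data.Maybe using (Maybe; just; nothing)
open import Data.Maybe.Properties using (≡-dec; just-injective)
open import Data.Nat as ℕ using (ℕ; zero; suc; _≤_; _<_; _∸_; z≤n; s≤s; _%_; _/_)
import Data.Nat.DivMod as DM
import Data.Nat.Properties as ℕₚ
open import Data.Product using (Σ; _×_; _,_; proj₁; proj₂)
open import Data.Sum using (_⊎_; inj₁; inj₂)
open import Function.Bundles using (mk⇔)
open import Relation.Binary.Bundles using (Setoid)
open import Relation.Binary.PropositionalEquality as ≡ using (_≡_; _≢_; refl; cong; cong₂; module ≡-Reasoning)
import Relation.Binary.Reasoning.Setoid as SetoidReasoning
open import Relation.Binary.Structures using (IsEquivalence)
open import Relation.Nullary using (¬_; Dec; yes; no; does; contradiction)
open import Relation.Nullary.Decidable using (decidable-stable; dec-true; does-⇔)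

open GroupProperties (AbelianGroup.group ℤₚ.+-0-abelianGroup) using () renaming (∙-cancelʳ to ℤ-cancelʳ)

-- Finite sums of integers and doubled indices.

sumTo : ℕ → (ℕ → ℤ) → ℤ
sumTo zero    h = 0ℤ
sumTo (suc k) h = sumTo k h ℤ.+ h k

sumTo-cong : ∀ k {h h′ : ℕ → ℤ} → (∀ i → h i ≡ h′ i) → sumTo k h ≡ sumTo k h′
sumTo-cong zero    e = refl
sumTo-cong (suc k) e = cong₂ ℤ._+_ (sumTo-cong k e) (e k)

sumTo-sub : ∀ k (h h′ : ℕ → ℤ) → sumTo k (λ i → h i ℤ.- h′ i) ≡ sumTo k h ℤ.- sumTo k h′
sumTo-sub zero    h h′ = refl
sumTo-sub (suc k) h h′ = ≡.trans (cong (ℤ._+ (h k ℤ.- h′ k)) (sumTo-sub k h h′))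
                               (lem (sumTo k h) (sumTo k h′) (h k) (h′ k))
  where
  lem : ∀ a b c d → (a ℤ.- b) ℤ.+ (c ℤ.- d) ≡ (a ℤ.+ c) ℤ.- (b ℤ.+ d)
  lem = solve-∀

sumTo-shift : ∀ k (h : ℕ → ℤ) → sumTo k (λ i → h (suc i)) ℤ.+ h 0 ≡ sumTo k h ℤ.+ h k
sumTo-shift zero    h = refl
sumTo-shift (suc k) h = begin
  (sumTo k (λ i → h (suc i)) ℤ.+ h (suc k)) ℤ.+ h 0 ≡⟨ lem (sumTo k (λ i → h (suc i))) (h (suc k)) (h 0) ⟩
  (sumTo k (λ i → h (suc i)) ℤ.+ h 0) ℤ.+ h (suc k) ≡⟨ cong (ℤ._+ h (suc k)) (sumTo-shift k h) ⟩
  (sumTo k h ℤ.+ h k) ℤ.+ h (suc k)                 ∎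
  where
  open ≡-Reasoning
  lem : ∀ a b c → (a ℤ.+ b) ℤ.+ c ≡ (a ℤ.+ c) ℤ.+ b
  lem = solve-∀

-- 2i + n, in a form that reduces when i is a successor
_⊕2*_ : ℕ → ℕ → ℕ
n ⊕2* zero  = n
n ⊕2* suc i = suc (suc (n ⊕2* i))

⊕2*-suc : ∀ n i → suc (suc n) ⊕2* i ≡ suc (suc (n ⊕2* i))
⊕2*-suc n zero    = refl
⊕2*-suc n (suc i) = cong (λ z → suc (suc z)) (⊕2*-suc n i)

suc-⊕2* : ∀ n i → suc n ⊕2* i ≡ suc (n ⊕2* i)
suc-⊕2* n zero    = refl
suc-⊕2* n (suc i) = cong (λ z → suc (suc z)) (suc-⊕2* n i)

0⊕2* : ∀ i → 0 ⊕2* i ≡ i ℕ.+ i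
0⊕2* zero    = refl
0⊕2* (suc i) = cong suc (≡.trans (cong suc (0⊕2* i)) (≡.sym (ℕₚ.+-suc i i)))

-- The discrete wave equation on a strip.

module Wave (m : ℕ) (G : ℕ → ℕ → ℤ)
  (left  : ∀ n → G n 0 ≡ 0ℤ)
  (right : ∀ n → G n m ≡ 0ℤ)
  (wave  : ∀ n y → suc y < m →
           G (2 ℕ.+ n) (suc y) ℤ.+ G n (suc y) ≡ G (suc n) (suc (suc y)) ℤ.+ G (suc n) y)
  where

  -- The recursion is `Split 1` solved for the later value. The two initial zeros are free choices,
  -- because only differences between indices of equal parity occur.
  F : ℕ → ℤ
  F 0             = 0ℤ
  F 1             = 0ℤ
  F (suc (suc n)) = F n ℤ.+ G (suc n) 1

  -- d'Alembert: a wave vanishing on the left boundary is a difference of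
  -- a left-moving and a right-moving copy of a single function.
  Split : ℕ → Set
  Split y = ∀ n → G (y ℕ.+ n) y ≡ F (n ⊕2* y) ℤ.- F n

  dalembert-step : ∀ y → suc y < m → Split y → Split (suc y) → Split (suc (suc y))
  dalembert-step y y<m ih₀ ih₁ n = begin
    G (2 ℕ.+ y ℕ.+ n) (2 ℕ.+ y)
      ≡⟨ cancel (wave (suc (y ℕ.+ n)) y y<m) ⟩
    (G (3 ℕ.+ y ℕ.+ n) (suc y) ℤ.+ G (suc y ℕ.+ n) (suc y)) ℤ.- G (2 ℕ.+ (y ℕ.+ n)) y
      ≡⟨ cong₂ ℤ._-_ (cong₂ ℤ._+_ g₁ (ih₁ n)) g₀ ⟩
    ((F (4 ℕ.+ (n ⊕2* y)) ℤ.- F (2 ℕ.+ n)) ℤ.+ (F (2 ℕ.+ (n ⊕2* y)) ℤ.- F n)) ℤ.- (F (2 ℕ.+ (n ⊕2* y)) ℤ.- F (2 ℕ.+ n))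
      ≡⟨ lem (F (4 ℕ.+ (n ⊕2* y))) (F (2 ℕ.+ n)) (F (2 ℕ.+ (n ⊕2* y))) (F n) ⟩
    F (n ⊕2* suc (suc y)) ℤ.- F n ∎
    where
    open ≡-Reasoning
    lem : ∀ a b c d → ((a ℤ.- b) ℤ.+ (c ℤ.- d)) ℤ.- (c ℤ.- b) ≡ a ℤ.- d
    lem = solve-∀
    cancel : ∀ {a b c} → a ≡ b ℤ.+ c → b ≡ a ℤ.- c
    cancel {_} {b} {c} refl = lem′ b c
      where
      lem′ : ∀ b c → b ≡ (b ℤ.+ c) ℤ.- c
      lem′ = solve-∀
    time : 2 ℕ.+ (y ℕ.+ n) ≡ y ℕ.+ (2 ℕ.+ n)
    time = ≡.sym (≡.trans (ℕₚ.+-suc y (suc n)) (cong suc (ℕₚ.+-suc y n)))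
    g₁ : G (3 ℕ.+ y ℕ.+ n) (suc y) ≡ F (4 ℕ.+ (n ⊕2* y)) ℤ.- F (2 ℕ.+ n)
    g₁ = ≡.trans (cong (λ z → G (suc z) (suc y)) time)
        (≡.trans (ih₁ (2 ℕ.+ n)) (cong (λ z → F (2 ℕ.+ z) ℤ.- F (2 ℕ.+ n)) (⊕2*-suc n y)))
    g₀ : G (2 ℕ.+ (y ℕ.+ n)) y ≡ F (2 ℕ.+ (n ⊕2* y)) ℤ.- F (2 ℕ.+ n)
    g₀ = ≡.trans (cong (λ z → G z y) time)
        (≡.trans (ih₀ (2 ℕ.+ n)) (cong (λ z → F z ℤ.- F (2 ℕ.+ n)) (⊕2*-suc n y)))

  dalembert : ∀ y → y ≤ m → Split y
  dalembert 0 _ n = ≡.trans (left n) (≡.sym (ℤₚ.+-inverseʳ (F n)))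
  dalembert 1 _ n = lem (F n) (G (suc n) 1)
    where
    lem : ∀ a b → b ≡ (a ℤ.+ b) ℤ.- a
    lem = solve-∀
  dalembert (suc (suc y)) y<m =
    dalembert-step y y<m (dalembert y (ℕₚ.<⇒≤ (ℕₚ.<⇒≤ y<m))) (dalembert (suc y) (ℕₚ.<⇒≤ y<m))

  -- At the right wall the difference in `dalembert` vanishes, and its two arguments lie 2m apart.
  F-periodic : ∀ n → F (n ⊕2* m) ≡ F n
  F-periodic n = ℤₚ.i-j≡0⇒i≡j _ _ (≡.trans (≡.sym (dalembert m ℕₚ.≤-refl n)) (right (m ℕ.+ n)))

  F-sum-shift : ∀ n → sumTo m (λ i → F ((2 ℕ.+ n) ⊕2* i)) ≡ sumTo m (λ i → F (n ⊕2* i))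
  F-sum-shift n = ℤ-cancelʳ (F n) _ _ (begin
    sumTo m (λ i → F ((2 ℕ.+ n) ⊕2* i)) ℤ.+ F n   ≡⟨ cong (ℤ._+ F n) (sumTo-cong m λ i → cong F (⊕2*-suc n i)) ⟩
    sumTo m (λ i → F (n ⊕2* suc i)) ℤ.+ F n     ≡⟨ sumTo-shift m (λ i → F (n ⊕2* i)) ⟩
    sumTo m (λ i → F (n ⊕2* i)) ℤ.+ F (n ⊕2* m) ≡⟨ cong (λ z → sumTo m (λ i → F (n ⊕2* i)) ℤ.+ z) (F-periodic n) ⟩
    sumTo m (λ i → F (n ⊕2* i)) ℤ.+ F n         ∎)
    where open ≡-Reasoning

  F-sum-shifts : ∀ n y → sumTo m (λ i → F ((n ⊕2* y) ⊕2* i)) ≡ sumTo m (λ i → F (n ⊕2* i))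
  F-sum-shifts n zero    = refl
  F-sum-shifts n (suc y) = ≡.trans (F-sum-shift (n ⊕2* y)) (F-sum-shifts n y)

  -- Both copies of `F` are summed over a full period 2m in steps of two, so the sums agree and
  -- cancel. Times start at `y` since `Split y` describes no earlier ones.
  late-sum≡0 : ∀ y → y ≤ m → ∀ n → sumTo m (λ i → G ((y ℕ.+ n) ⊕2* i) y) ≡ 0ℤ
  late-sum≡0 y y≤m n = begin
    sumTo m (λ i → G ((y ℕ.+ n) ⊕2* i) y)
      ≡⟨ sumTo-cong m (λ i → ≡.trans (cong (λ z → G z y) (time i)) (dalembert y y≤m (n ⊕2* i))) ⟩
    sumTo m (λ i → F ((n ⊕2* i) ⊕2* y) ℤ.- F (n ⊕2* i))
      ≡⟨ sumTo-sub m _ _ ⟩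
    sumTo m (λ i → F ((n ⊕2* i) ⊕2* y)) ℤ.- sumTo m (λ i → F (n ⊕2* i))
      ≡⟨ cong₂ ℤ._-_ (≡.trans (sumTo-cong m λ i → cong F (comm i y)) (F-sum-shifts n y)) refl ⟩
    sumTo m (λ i → F (n ⊕2* i)) ℤ.- sumTo m (λ i → F (n ⊕2* i))
      ≡⟨ ℤₚ.+-inverseʳ (sumTo m (λ i → F (n ⊕2* i))) ⟩
    0ℤ ∎
    where
    open ≡-Reasoning
    time : ∀ i → (y ℕ.+ n) ⊕2* i ≡ y ℕ.+ (n ⊕2* i)
    time zero    = refl
    time (suc i) = ≡.trans (cong (λ z → suc (suc z)) (time i))
                           (≡.sym (≡.trans (ℕₚ.+-suc y _) (cong suc (ℕₚ.+-suc y _))))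
    comm : ∀ i j → (n ⊕2* i) ⊕2* j ≡ (n ⊕2* j) ⊕2* i
    comm i zero    = refl
    comm i (suc j) = ≡.trans (cong (λ z → suc (suc z)) (comm i j)) (≡.sym (⊕2*-suc (n ⊕2* j) i))

-- The Chebyshev recursion on disjoint paths.

Seq : Set
Seq = ℕ → ℤ

-- The first argument is a residue modulo the block length; residue zero marks the edge between two
-- blocks, which is cut.
pick : ℕ → ℤ → ℤ
pick zero    z = 0ℤ
pick (suc _) z = z

-- Replaces multiplication by 2 cos (π / m) in the geometric representation.  For
-- 2 ≤ m < ∞ it is the adjacency operator of a disjoint union of paths with m - 1
-- vertices (eigenvalues 2 cos (jπ / m), 0 < j < m), ℕ being cut into consecutive blocks
-- of that size; m = 1 and m = ∞ give -2 and 2.  A Coxeter matrix has no entry 0.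
κ : Maybe ℕ → Seq → Seq
κ nothing              φ i = φ i ℤ.+ φ i
κ (just 0)             φ i = 0ℤ
κ (just 1)             φ i = ℤ.- φ i ℤ.- φ i
κ (just (suc (suc k))) φ i = pick (i % suc k) (φ (ℕ.pred i)) ℤ.+ pick (suc i % suc k) (φ (suc i))

pick-+ : ∀ r a b → pick r (a ℤ.+ b) ≡ pick r a ℤ.+ pick r b
pick-+ zero    a b = refl
pick-+ (suc r) a b = refl

pick-0 : ∀ r → pick r 0ℤ ≡ 0ℤ
pick-0 zero    = refl
pick-0 (suc r) = refl

κ-cong : ∀ μ {φ ψ : Seq} → (∀ i → φ i ≡ ψ i) → ∀ i → κ μ φ i ≡ κ μ ψ i
κ-cong nothing              e i = cong₂ ℤ._+_ (e i) (e i)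
κ-cong (just 0)             e i = refl
κ-cong (just 1)             e i = cong₂ (λ a b → ℤ.- a ℤ.- b) (e i) (e i)
κ-cong (just (suc (suc k))) e i = cong₂ (λ a b → pick (i % suc k) a ℤ.+ pick (suc i % suc k) b) (e (ℕ.pred i)) (e (suc i))

κ-+ : ∀ μ (φ ψ : Seq) i → κ μ (λ j → φ j ℤ.+ ψ j) i ≡ κ μ φ i ℤ.+ κ μ ψ i
κ-+ nothing φ ψ i = lem (φ i) (ψ i)
  where
  lem : ∀ a b → (a ℤ.+ b) ℤ.+ (a ℤ.+ b) ≡ (a ℤ.+ a) ℤ.+ (b ℤ.+ b)
  lem = solve-∀
κ-+ (just 0) φ ψ i = refl
κ-+ (just 1) φ ψ i = lem (φ i) (ψ i)
  where
  lem : ∀ a b → ℤ.- (a ℤ.+ b) ℤ.- (a ℤ.+ b) ≡ (ℤ.- a ℤ.- a) ℤ.+ (ℤ.- b ℤ.- b)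
  lem = solve-∀
κ-+ (just (suc (suc k))) φ ψ i = begin
  pick r (φ (ℕ.pred i) ℤ.+ ψ (ℕ.pred i)) ℤ.+ pick r′ (φ (suc i) ℤ.+ ψ (suc i))
    ≡⟨ cong₂ ℤ._+_ (pick-+ r (φ (ℕ.pred i)) (ψ (ℕ.pred i))) (pick-+ r′ (φ (suc i)) (ψ (suc i))) ⟩
  (pick r (φ (ℕ.pred i)) ℤ.+ pick r (ψ (ℕ.pred i))) ℤ.+ (pick r′ (φ (suc i)) ℤ.+ pick r′ (ψ (suc i)))
    ≡⟨ lem (pick r (φ (ℕ.pred i))) (pick r (ψ (ℕ.pred i))) (pick r′ (φ (suc i))) (pick r′ (ψ (suc i))) ⟩
  (pick r (φ (ℕ.pred i)) ℤ.+ pick r′ (φ (suc i))) ℤ.+ (pick r (ψ (ℕ.pred i)) ℤ.+ pick r′ (ψ (suc i))) ∎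
  where
  open ≡-Reasoning
  r r′ : ℕ
  r  = i % suc k
  r′ = suc i % suc k
  lem : ∀ a b c d → (a ℤ.+ b) ℤ.+ (c ℤ.+ d) ≡ (a ℤ.+ c) ℤ.+ (b ℤ.+ d)
  lem = solve-∀

κ-0 : ∀ μ i → κ μ (λ _ → 0ℤ) i ≡ 0ℤ
κ-0 nothing              i = refl
κ-0 (just 0)             i = refl
κ-0 (just 1)             i = refl
κ-0 (just (suc (suc k))) i = cong₂ ℤ._+_ (pick-0 (i % suc k)) (pick-0 (suc i % suc k))

κ-sum : ∀ μ k (φ : ℕ → Seq) i → κ μ (λ j → sumTo k (λ n → φ n j)) i ≡ sumTo k (λ n → κ μ (φ n) i)
κ-sum μ zero    φ i = κ-0 μ i
κ-sum μ (suc k) φ i = ≡.trans (κ-+ μ _ _ i) (cong (ℤ._+ κ μ (φ k) i) (κ-sum μ k φ i))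

-- The three-term recursion of the Chebyshev polynomials in `κ μ`, with free initial terms. On a
-- path it is the discrete wave equation.
cheb : Maybe ℕ → Seq → Seq → ℕ → Seq
cheb μ p q 0             i = p i
cheb μ p q 1             i = q i
cheb μ p q (suc (suc n)) i = κ μ (cheb μ p q (suc n)) i ℤ.- cheb μ p q n i

module Strip (k : ℕ) where

  N : ℕ
  N = suc k

  -- Block `b` placed between two walls: positions 1 to `N` carry its values, 0 and `N` + 1 carry
  -- zero. Then `κ` is the sum of both neighbours, with no exception at the ends.
  strip : ℕ → Seq → ℕ → ℤ
  strip b φ zero    = 0ℤ
  strip b φ (suc y) = pick (N ∸ y) (φ (y ℕ.+ b ℕ.* N))

  κ-strip : ∀ b φ y → y < N → κ (just (suc N)) φ (y ℕ.+ b ℕ.* N) ≡ strip b φ (2 ℕ.+ y) ℤ.+ strip b φ y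
  κ-strip b φ y y<N = ≡.trans (cong₂ ℤ._+_ (lo y y<N) hi) (ℤₚ.+-comm (strip b φ y) (strip b φ (2 ℕ.+ y)))
    where
    residue : ∀ y → y < N → (y ℕ.+ b ℕ.* N) % N ≡ y
    residue y y<N = ≡.trans (DM.[m+kn]%n≡m%n y b N) (DM.m<n⇒m%n≡m y<N)
    lo : ∀ y → y < N → pick ((y ℕ.+ b ℕ.* N) % N) (φ (ℕ.pred (y ℕ.+ b ℕ.* N))) ≡ strip b φ y
    lo zero y<N rewrite residue zero y<N = refl
    lo (suc y) y<N rewrite residue (suc y) y<N with N ∸ y | ℕₚ.m<n⇒0<n∸m (ℕₚ.<⇒≤ y<N)
    ... | suc _ | _ = refl
    hi : pick (suc (y ℕ.+ b ℕ.* N) % N) (φ (suc (y ℕ.+ b ℕ.* N))) ≡ strip b φ (2 ℕ.+ y)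
    hi with suc y ℕ.<? N
    ... | yes sy<N rewrite residue (suc y) sy<N with N ∸ suc y | ℕₚ.m<n⇒0<n∸m sy<N
    ...   | suc _ | _ = refl
    hi | no sy≮N with ℕₚ.≤-antisym y<N (ℕₚ.≮⇒≥ sy≮N)
    ...   | refl rewrite ℕₚ.n∸n≡0 k | ≡.trans (DM.[m+kn]%n≡m%n N b N) (DM.n%n≡0 N) = refl

  strip-value : ∀ b φ y → y < N → strip b φ (suc y) ≡ φ (y ℕ.+ b ℕ.* N)
  strip-value b φ y y<N with N ∸ y | ℕₚ.m<n⇒0<n∸m y<N
  ... | suc _ | _ = refl

  strip-end : ∀ b φ → strip b φ (suc N) ≡ 0ℤ
  strip-end b φ rewrite ℕₚ.n∸n≡0 k = refl

-- Each block solves the wave equation between zero walls, so `Wave.late-sum≡0` settles all late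
-- `e`; reversing the recursion reaches the others. This vanishing is what makes (st)^m act
-- trivially.
cheb-sum≡0 : ∀ k p q e i → sumTo (2 ℕ.+ k) (λ n → cheb (just (2 ℕ.+ k)) p q (e ⊕2* n) i) ≡ 0ℤ
cheb-sum≡0 k p q = all (2 ℕ.+ k) late
  where
  open Strip k
  open ≡-Reasoning
  M : ℕ
  M = 2 ℕ.+ k
  c : ℕ → Seq
  c = cheb (just M) p q
  total : ℕ → Seq
  total e i = sumTo M (λ n → c (e ⊕2* n) i)
  back : ∀ b c → c ≡ b ℤ.- (b ℤ.- c)
  back = solve-∀
  total-rec : ∀ e i → total e i ≡ κ (just M) (total (suc e)) i ℤ.- total (2 ℕ.+ e) i
  total-rec e i = begin
    total e i
      ≡⟨ sumTo-cong M (λ n → back (κ (just M) (c (suc (e ⊕2* n))) i) (c (e ⊕2* n) i)) ⟩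
    sumTo M (λ n → κ (just M) (c (suc (e ⊕2* n))) i ℤ.- c (2 ℕ.+ (e ⊕2* n)) i)
      ≡⟨ sumTo-cong M (λ n → cong₂ (λ a b → κ (just M) (c a) i ℤ.- c b i) (≡.sym (suc-⊕2* e n)) (≡.sym (⊕2*-suc e n))) ⟩
    sumTo M (λ n → κ (just M) (c (suc e ⊕2* n)) i ℤ.- c ((2 ℕ.+ e) ⊕2* n) i)
      ≡⟨ sumTo-sub M _ _ ⟩
    sumTo M (λ n → κ (just M) (c (suc e ⊕2* n)) i) ℤ.- total (2 ℕ.+ e) i
      ≡⟨ cong (ℤ._- total (2 ℕ.+ e) i) (≡.sym (κ-sum (just M) M (λ n → c (suc e ⊕2* n)) i)) ⟩
    κ (just M) (total (suc e)) i ℤ.- total (2 ℕ.+ e) i ∎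
  G : ℕ → ℕ → ℕ → ℤ
  G b n y = strip b (c n) y
  wave : ∀ b n y → suc y < M → G b (2 ℕ.+ n) (suc y) ℤ.+ G b n (suc y) ≡ G b (suc n) (2 ℕ.+ y) ℤ.+ G b (suc n) y
  wave b n y (s≤s y<N) = begin
    G b (2 ℕ.+ n) (suc y) ℤ.+ G b n (suc y)
      ≡⟨ cong₂ ℤ._+_ (strip-value b (c (2 ℕ.+ n)) y y<N) (strip-value b (c n) y y<N) ⟩
    (κ (just M) (c (suc n)) (y ℕ.+ b ℕ.* N) ℤ.- c n (y ℕ.+ b ℕ.* N)) ℤ.+ c n (y ℕ.+ b ℕ.* N)
      ≡⟨ lem (κ (just M) (c (suc n)) (y ℕ.+ b ℕ.* N)) (c n (y ℕ.+ b ℕ.* N)) ⟩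
    κ (just M) (c (suc n)) (y ℕ.+ b ℕ.* N)
      ≡⟨ κ-strip b (c (suc n)) y y<N ⟩
    G b (suc n) (2 ℕ.+ y) ℤ.+ G b (suc n) y ∎
    where
    lem : ∀ a b → (a ℤ.- b) ℤ.+ b ≡ a
    lem = solve-∀
  late : ∀ e i → total (M ℕ.+ e) i ≡ 0ℤ
  late e i = begin
    total (M ℕ.+ e) i
      ≡⟨ cong₂ (λ t j → sumTo M (λ n → c (t ⊕2* n) j)) time (DM.m≡m%n+[m/n]*n i N) ⟩
    sumTo M (λ n → c ((y ℕ.+ e′) ⊕2* n) (r ℕ.+ b ℕ.* N))
      ≡⟨ sumTo-cong M (λ n → ≡.sym (strip-value b (c ((y ℕ.+ e′) ⊕2* n)) r (DM.m%n<n i N))) ⟩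
    sumTo M (λ n → G b ((y ℕ.+ e′) ⊕2* n) y)
      ≡⟨ Wave.late-sum≡0 M (G b) (λ _ → refl) (λ n → strip-end b (c n)) (wave b) y y≤M e′ ⟩
    0ℤ ∎
    where
    r b y e′ : ℕ
    r = i % N
    b = i / N
    y = suc r
    -- Position `y` is controlled from time `y` on, so the starting time `M + e` is rewritten as
    -- `y + e′`.
    e′ = (M ∸ y) ℕ.+ e
    y≤M : y ≤ M
    y≤M = ℕₚ.m≤n⇒m≤1+n (DM.m%n<n i N)
    time : M ℕ.+ e ≡ y ℕ.+ e′
    time = ≡.trans (cong (ℕ._+ e) (≡.sym (ℕₚ.m+[n∸m]≡n y≤M))) (ℕₚ.+-assoc y (M ∸ y) e)
  -- The recursion can be run backwards in time.
  all : ∀ d → (∀ e i → total (d ℕ.+ e) i ≡ 0ℤ) → ∀ e i → total e i ≡ 0ℤ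
  all zero    h = h
  all (suc d) h = all d h′
    where
    h′ : ∀ e i → total (d ℕ.+ e) i ≡ 0ℤ
    h′ zero i = ≡.trans (total-rec (d ℕ.+ 0) i) (cong₂ ℤ._-_
      (≡.trans (κ-cong (just M) (h 0) i) (κ-0 (just M) i))
      (≡.trans (cong (λ z → total (suc z) i) (≡.sym (ℕₚ.+-suc d 0))) (h 1 i)))
    h′ (suc e) i = ≡.trans (cong (λ z → total z i) (ℕₚ.+-suc d e)) (h e i)

module StandingWave (k : ℕ) where
  open Strip k

  M : ℕ
  M = suc N

  δ : ℕ → ℤ
  δ zero    = 1ℤ
  δ (suc _) = 0ℤ

  E : ℕ → ℤ
  E z = δ (z % (M ℕ.+ M))

  E-periodic : ∀ z → E (z ℕ.+ (M ℕ.+ M)) ≡ E z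
  E-periodic z = cong δ (DM.[m+n]%n≡m%n z (M ℕ.+ M))

  E-small : ∀ z → 0 < z → z < M ℕ.+ M → E z ≡ 0ℤ
  E-small (suc z) _ z<2M = cong δ (DM.m<n⇒m%n≡m z<2M)

  -E≢1 : ∀ z → 0ℤ ℤ.- E z ≢ 1ℤ
  -E≢1 z with z % (M ℕ.+ M)
  ... | zero  = λ ()
  ... | suc _ = λ ()

  -- Pulses of opposite sign running in opposite directions, each of period 2M; they cancel at both
  -- walls. `M + (M ∸ y)` is 2M - y, kept inside the naturals.
  w : ℕ → ℕ → ℤ
  w n y = E (n ℕ.+ (M ℕ.+ (M ∸ y))) ℤ.- E (n ℕ.+ y)

  c : ℕ → Seq
  c n i = w n (suc (i % N))

  c-block : ∀ n b y → y < N → c n (y ℕ.+ b ℕ.* N) ≡ w n (suc y)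
  c-block n b y y<N = cong (λ z → w n (suc z)) (≡.trans (DM.[m+kn]%n≡m%n y b N) (DM.m<n⇒m%n≡m y<N))

  strip-c : ∀ n b y → y ≤ M → strip b (c n) y ≡ w n y
  strip-c n b zero _ = ≡.sym (ℤₚ.i≡j⇒i-j≡0 (≡.trans (E-periodic n) (cong E (≡.sym (ℕₚ.+-identityʳ n)))))
  strip-c n b (suc y) (s≤s y≤N) with ℕₚ.m≤n⇒m<n∨m≡n y≤N
  ... | inj₁ y<N  = ≡.trans (strip-value b (c n) y y<N) (c-block n b y y<N)
  ... | inj₂ refl = ≡.trans (strip-end b (c n)) (≡.sym (ℤₚ.i≡j⇒i-j≡0 (cong (λ z → E (n ℕ.+ z)) fold)))
    where
    fold : M ℕ.+ (M ∸ M) ≡ M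
    fold = ≡.trans (cong (M ℕ.+_) (ℕₚ.n∸n≡0 M)) (ℕₚ.+-identityʳ M)

  c-rec : ∀ n i → c (2 ℕ.+ n) i ≡ κ (just M) (c (suc n)) i ℤ.- c n i
  c-rec n i = begin
    w (2 ℕ.+ n) (suc r)
      ≡⟨ cong₂ ℤ._-_ (cong E t₁) (cong E t₂) ⟩
    E (suc n ℕ.+ (M ℕ.+ (M ∸ r))) ℤ.- E (suc n ℕ.+ (2 ℕ.+ r))
      ≡⟨ lem (E (suc n ℕ.+ (M ℕ.+ (M ∸ (2 ℕ.+ r))))) (E (suc n ℕ.+ (2 ℕ.+ r))) (E (suc n ℕ.+ (M ℕ.+ (M ∸ r)))) (E (suc n ℕ.+ r)) ⟩
    (w (suc n) (2 ℕ.+ r) ℤ.+ w (suc n) r) ℤ.- (E (suc n ℕ.+ (M ℕ.+ (M ∸ (2 ℕ.+ r)))) ℤ.- E (suc n ℕ.+ r))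
      ≡⟨ cong₂ ℤ._-_ κw (cong₂ ℤ._-_ (cong E t₃) (cong E (≡.sym (ℕₚ.+-suc n r)))) ⟩
    κ (just M) (c (suc n)) i ℤ.- w n (suc r) ∎
    where
    open ≡-Reasoning
    r b : ℕ
    r = i % N
    b = i / N
    r<N : r < N
    r<N = DM.m%n<n i N
    lem : ∀ p q s t → s ℤ.- q ≡ ((p ℤ.- q) ℤ.+ (s ℤ.- t)) ℤ.- (p ℤ.- t)
    lem = solve-∀
    shift : ∀ n x y → n ℕ.+ (x ℕ.+ suc y) ≡ suc n ℕ.+ (x ℕ.+ y)
    shift n x y = ≡.trans (cong (n ℕ.+_) (ℕₚ.+-suc x y)) (ℕₚ.+-suc n (x ℕ.+ y))
    down : ∀ y → y < M → M ∸ y ≡ suc (M ∸ suc y)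
    down y y<M = ℕₚ.+-∸-assoc 1 {M} {suc y} y<M
    t₁ : (2 ℕ.+ n) ℕ.+ (M ℕ.+ (M ∸ suc r)) ≡ suc n ℕ.+ (M ℕ.+ (M ∸ r))
    t₁ = ≡.sym (≡.trans (cong (λ z → suc n ℕ.+ (M ℕ.+ z)) (down r (ℕₚ.m≤n⇒m≤1+n r<N))) (shift (suc n) M _))
    t₂ : (2 ℕ.+ n) ℕ.+ suc r ≡ suc n ℕ.+ (2 ℕ.+ r)
    t₂ = ≡.sym (ℕₚ.+-suc (suc n) (suc r))
    t₃ : suc n ℕ.+ (M ℕ.+ (M ∸ (2 ℕ.+ r))) ≡ n ℕ.+ (M ℕ.+ (M ∸ suc r))
    t₃ = ≡.sym (≡.trans (cong (λ z → n ℕ.+ (M ℕ.+ z)) (down (suc r) (s≤s r<N))) (shift n M _))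
    κw : w (suc n) (2 ℕ.+ r) ℤ.+ w (suc n) r ≡ κ (just M) (c (suc n)) i
    κw = begin
      w (suc n) (2 ℕ.+ r) ℤ.+ w (suc n) r
        ≡⟨ cong₂ ℤ._+_ (≡.sym (strip-c (suc n) b (2 ℕ.+ r) (s≤s r<N)))
                       (≡.sym (strip-c (suc n) b r (ℕₚ.m≤n⇒m≤1+n (ℕₚ.<⇒≤ r<N)))) ⟩
      strip b (c (suc n)) (2 ℕ.+ r) ℤ.+ strip b (c (suc n)) r
        ≡⟨ ≡.sym (κ-strip b (c (suc n)) r r<N) ⟩
      κ (just M) (c (suc n)) (r ℕ.+ b ℕ.* N)
        ≡⟨ cong (κ (just M) (c (suc n))) (≡.sym (DM.m≡m%n+[m/n]*n i N)) ⟩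
      κ (just M) (c (suc n)) i ∎

  cheb-c : ∀ n i → cheb (just M) (c 0) (c 1) n i ≡ c n i
  cheb-c n = proj₁ (both n)
    where
    both : ∀ n → (∀ i → cheb (just M) (c 0) (c 1) n i ≡ c n i) × (∀ i → cheb (just M) (c 0) (c 1) (suc n) i ≡ c (suc n) i)
    both zero    = (λ _ → refl) , (λ _ → refl)
    both (suc n) with both n
    ... | p , q = q , λ i → ≡.trans (cong₂ ℤ._-_ (κ-cong (just M) q i) (p i)) (≡.sym (c-rec n i))


  value-zero : ∀ d → c (1 ⊕2* d) 0 ≡ E (0 ⊕2* d) ℤ.- E (2 ⊕2* d)
  value-zero d = cong₂ ℤ._-_ (≡.trans (cong E (odd d)) (E-periodic (0 ⊕2* d))) (cong E (odd′ d))
    where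
    odd : ∀ d → (1 ⊕2* d) ℕ.+ (M ℕ.+ N) ≡ (0 ⊕2* d) ℕ.+ (M ℕ.+ M)
    odd zero    = ≡.sym (ℕₚ.+-suc M N)
    odd (suc d) = cong (λ z → suc (suc z)) (odd d)
    odd′ : ∀ d → (1 ⊕2* d) ℕ.+ 1 ≡ 2 ⊕2* d
    odd′ zero    = refl
    odd′ (suc d) = cong (λ z → suc (suc z)) (odd′ d)

  -- At the first vertex and time 1 + 2d, one pulse contributes `E` at 2d and the other 0 or -1. The
  -- value 1 taken at d = 0 therefore cannot recur before 2d reaches the period 2M.
  c-aperiodic : ∀ d → 0 < d → d < M → c (1 ⊕2* d) 0 ≢ c 1 0
  c-aperiodic d 0<d d<M eq = -E≢1 (2 ⊕2* d) (begin
    0ℤ ℤ.- E (2 ⊕2* d)            ≡⟨ cong (ℤ._- E (2 ⊕2* d)) (≡.sym (E-small (0 ⊕2* d) (pos 0<d) (small d<M))) ⟩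
    E (0 ⊕2* d) ℤ.- E (2 ⊕2* d)   ≡⟨ ≡.sym (value-zero d) ⟩
    c (1 ⊕2* d) 0                 ≡⟨ eq ⟩
    c 1 0                         ≡⟨ value-zero 0 ⟩
    E 0 ℤ.- E 2                   ≡⟨ cong (λ z → E 0 ℤ.- z) (E-small 2 (s≤s z≤n) (s≤s (s≤s (ℕₚ.≤-trans (s≤s z≤n) (ℕₚ.m≤n+m M k))))) ⟩
    1ℤ                            ∎)
    where
    open ≡-Reasoning
    pos : ∀ {d} → 0 < d → 0 < 0 ⊕2* d
    pos {suc d} _ = s≤s z≤n
    small : ∀ {d} → d < M → 0 ⊕2* d < M ℕ.+ M
    small {d} d<M = ≡.subst (_< M ℕ.+ M) (≡.sym (0⊕2* d)) (ℕₚ.+-mono-< d<M d<M)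

cheb-linear : ∀ n i → cheb nothing (λ _ → 0ℤ) (λ _ → 1ℤ) n i ≡ + n
cheb-linear 0 i = refl
cheb-linear 1 i = refl
cheb-linear (suc (suc n)) i =
  ≡.trans (cong₂ (λ a b → (a ℤ.+ a) ℤ.- b) (cheb-linear (suc n) i) (cheb-linear n i)) (lem (+ n))
  where
  lem : ∀ a → ((1ℤ ℤ.+ a) ℤ.+ (1ℤ ℤ.+ a)) ℤ.- a ≡ + 2 ℤ.+ a
  lem = solve-∀

-- The witness that st has no smaller order: the sequence n when there is no relation, the standing
-- wave otherwise.
cheb-aperiodic : ∀ μ → (∀ k → μ ≡ just k → 2 ≤ k) → Σ Seq λ p → Σ Seq λ q →
  ∀ d → 0 < d → (∀ k → μ ≡ just k → d < k) → cheb μ p q (1 ⊕2* d) 0 ≢ q 0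
cheb-aperiodic nothing _ = (λ _ → 0ℤ) , (λ _ → 1ℤ) , λ { (suc d) _ _ eq → absurd (≡.trans (≡.sym (cheb-linear (1 ⊕2* suc d) 0)) eq) }
  where
  absurd : ∀ {n} → + (suc (suc n)) ≢ + 1
  absurd ()
cheb-aperiodic (just 0) 2≤ = contradiction (2≤ 0 refl) λ ()
cheb-aperiodic (just 1) 2≤ = contradiction (2≤ 1 refl) λ { (s≤s ()) }
cheb-aperiodic (just (suc (suc k))) _ = c 0 , c 1 , λ d 0<d d<M eq →
    c-aperiodic d 0<d (d<M M refl) (≡.trans (≡.sym (cheb-c (1 ⊕2* d) 0)) eq)
  where open StandingWave k

-- The Coxeter group as words modulo relations.

module Basics (C : CoxeterMatrix) where
  open CoxeterMatrix C renaming (sym to m-sym) public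
  open Coxeter C renaming (refl to ≈-refl; symm to ≈-sym; trans to ≈-trans) public

  ≈-reflexive : ∀ {x y} → x ≡ y → x ≈ y
  ≈-reflexive refl = ≈-refl

  ≈-isEquivalence : IsEquivalence _≈_
  ≈-isEquivalence = record { refl = ≈-refl ; sym = ≈-sym ; trans = ≈-trans }

  W-setoid : Setoid 0ℓ 0ℓ
  W-setoid = record { isEquivalence = ≈-isEquivalence }

  ++-congˡ : ∀ c {x y} → x ≈ y → (c ++ x) ≈ (c ++ y)
  ++-congˡ c (rel {s} {t} {k} p a b) =
    ≡.subst₂ _≈_ (Listₚ.++-assoc c a (alt s t k ++ b)) (Listₚ.++-assoc c a b) (rel p (c ++ a) b)
  ++-congˡ c ≈-refl        = ≈-refl
  ++-congˡ c (≈-sym e)     = ≈-sym (++-congˡ c e)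
  ++-congˡ c (≈-trans e f) = ≈-trans (++-congˡ c e) (++-congˡ c f)

  ++-congʳ : ∀ c {x y} → x ≈ y → (x ++ c) ≈ (y ++ c)
  ++-congʳ c (rel {s} {t} {k} p a b) =
    ≡.subst₂ _≈_ (≡.sym (≡.trans (Listₚ.++-assoc a (alt s t k ++ b) c) (cong (a ++_) (Listₚ.++-assoc (alt s t k) b c))))
                 (≡.sym (Listₚ.++-assoc a b c)) (rel p a (b ++ c))
  ++-congʳ c ≈-refl        = ≈-refl
  ++-congʳ c (≈-sym e)     = ≈-sym (++-congʳ c e)
  ++-congʳ c (≈-trans e f) = ≈-trans (++-congʳ c e) (++-congʳ c f)

  ++-cong : ∀ {x y u v} → x ≈ y → u ≈ v → (x ++ u) ≈ (y ++ v)
  ++-cong {y = y} {u = u} e f = ≈-trans (++-congʳ u e) (++-congˡ y f)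

  ∷-cong : ∀ s {x y} → x ≈ y → (s ∷ x) ≈ (s ∷ y)
  ∷-cong s = ++-congˡ [ s ]

  ss≈ : ∀ s w → (s ∷ s ∷ w) ≈ w
  ss≈ s w = rel (diag s) [] w

  inverseʳ : ∀ w → (w ++ reverse w) ≈ []
  inverseʳ []      = ≈-refl
  inverseʳ (s ∷ w) = ≈-trans (≈-reflexive eq) (≈-trans (∷-cong s (++-congʳ [ s ] (inverseʳ w))) (ss≈ s []))
    where
    eq : s ∷ w ++ reverse (s ∷ w) ≡ s ∷ (w ++ reverse w) ++ [ s ]
    eq = cong (s ∷_) (≡.trans (cong (w ++_) (Listₚ.unfold-reverse s w)) (≡.sym (Listₚ.++-assoc w (reverse w) [ s ])))

  inverseˡ : ∀ w → (reverse w ++ w) ≈ []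
  inverseˡ w = ≈-trans (≈-reflexive (cong (reverse w ++_) (≡.sym (Listₚ.reverse-involutive w)))) (inverseʳ (reverse w))

  reverse-cong : ∀ {x y} → x ≈ y → reverse x ≈ reverse y
  reverse-cong {x} {y} e = begin
    reverse x                        ≡⟨ ≡.sym (Listₚ.++-identityʳ (reverse x)) ⟩
    reverse x ++ []                  ≈⟨ ++-congˡ (reverse x) (≈-sym (inverseʳ y)) ⟩
    reverse x ++ (y ++ reverse y)    ≈⟨ ++-congˡ (reverse x) (++-congʳ (reverse y) (≈-sym e)) ⟩
    reverse x ++ (x ++ reverse y)    ≡⟨ ≡.sym (Listₚ.++-assoc (reverse x) x (reverse y)) ⟩
    (reverse x ++ x) ++ reverse y    ≈⟨ ++-congʳ (reverse y) (inverseˡ x) ⟩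
    reverse y                        ∎
    where open SetoidReasoning W-setoid

  W : Group 0ℓ 0ℓ
  W = record
    { Carrier = Word ; _≈_ = _≈_ ; _∙_ = _++_ ; ε = [] ; _⁻¹ = reverse
    ; isGroup = record
      { isMonoid = record
        { isSemigroup = record
          { isMagma = record
            { isEquivalence = ≈-isEquivalence
            ; ∙-cong = ++-cong }
          ; assoc = λ x y z → ≈-reflexive (Listₚ.++-assoc x y z) }
        ; identity = (λ _ → ≈-refl) , (λ x → ≈-reflexive (Listₚ.++-identityʳ x)) }
      ; inverse = inverseˡ , inverseʳ
      ; ⁻¹-cong = reverse-cong } }

  open GroupProperties W public using (∙-cancelˡ; ∙-cancelʳ)

  flip-∷ : ∀ {s x y} → (s ∷ x) ≈ y → x ≈ (s ∷ y)
  flip-∷ {s} {x} e = ≈-trans (≈-sym (ss≈ s x)) (∷-cong s e)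

  ∷-cancel : ∀ s {x y} → (s ∷ x) ≈ (s ∷ y) → x ≈ y
  ∷-cancel s {y = y} e = ≈-trans (flip-∷ e) (ss≈ s y)

  -- `offdiag` only refutes `s ≢ t`; without a decision of equality on `S` this stays a double
  -- negation. In the group, `m≡1⇒≈` gives an actual equality.
  m≡1⇒¬¬≡ : ∀ {s t} → m s t ≡ just 1 → ¬ s ≢ t
  m≡1⇒¬¬≡ e s≢t with offdiag _ _ s≢t 1 e
  ... | s≤s ()

  m≡1⇒≈ : ∀ {s t} → m s t ≡ just 1 → [ s ] ≈ [ t ]
  m≡1⇒≈ e = ≈-sym (flip-∷ (rel e [] []))

  m≢1⇒2≤ : ∀ {s t} → m s t ≢ just 1 → ∀ k → m s t ≡ just k → 2 ≤ k
  m≢1⇒2≤ {s} {t} ne = offdiag s t λ { refl → ne (diag s) }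

-- An integral geometric representation and the order of st.

module Representation (C : CoxeterMatrix) where
  open Basics C

  State : Set
  State = S → Seq

  -- The contragredient geometric representation: `f a` plays the value of a functional at the
  -- simple root of `a`, and `κ (m s a)` the scalar -2B(a,s).
  act : S → State → State
  act s f a i = f a i ℤ.+ κ (m s a) (f s) i

  acts : Word → State → State
  acts []      f = f
  acts (s ∷ w) f = act s (acts w f)

  infix 4 _≗_
  _≗_ : State → State → Set
  f ≗ g = ∀ a i → f a i ≡ g a i

  act-cong : ∀ s {f g} → f ≗ g → act s f ≗ act s g
  act-cong s e a i = cong₂ ℤ._+_ (e a i) (κ-cong (m s a) (e s) i)

  acts-cong : ∀ w {f g} → f ≗ g → acts w f ≗ acts w g
  acts-cong []      e = e
  acts-cong (s ∷ w) e = act-cong s (acts-cong w e)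

  acts-++ : ∀ x y f → acts (x ++ y) f ≡ acts x (acts y f)
  acts-++ []      y f = refl
  acts-++ (s ∷ x) y f = cong (act s) (acts-++ x y f)

  module Alternating (s t : S) (f : State) where

    -- With this initial sign the coordinates at `s` and `t` belong to one sequence: acting by
    -- either generator turns the other coordinate into the next term and negates its own.
    c : ℕ → Seq
    c = cheb (m s t) (λ i → ℤ.- f s i) (f t)

    cancel : ∀ a → a ℤ.+ (ℤ.- a ℤ.- a) ≡ ℤ.- a
    cancel = solve-∀

    after : ℕ → State
    after k = acts (alt s t k) f

    Values : ℕ → Set
    Values k = (∀ i → after k s i ≡ ℤ.- c (0 ⊕2* k) i) × (∀ i → after k t i ≡ c (1 ⊕2* k) i)

    module Step (k : ℕ) (vs : ∀ i → after k s i ≡ ℤ.- c (0 ⊕2* k) i) (vt : ∀ i → after k t i ≡ c (1 ⊕2* k) i) where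
      open ≡-Reasoning

      swap : ∀ a b → ℤ.- a ℤ.+ b ≡ b ℤ.- a
      swap = solve-∀

      t-then-s : ∀ i → act t (after k) s i ≡ c (0 ⊕2* suc k) i
      t-then-s i = begin
        after k s i ℤ.+ κ (m t s) (after k t) i
          ≡⟨ cong₂ ℤ._+_ (vs i) (≡.trans (κ-cong (m t s) vt i) (cong₂ (λ μ n → κ μ (c n) i) (m-sym t s) (suc-⊕2* 0 k))) ⟩
        ℤ.- c (0 ⊕2* k) i ℤ.+ κ (m s t) (c (suc (0 ⊕2* k))) i
          ≡⟨ swap (c (0 ⊕2* k) i) (κ (m s t) (c (suc (0 ⊕2* k))) i) ⟩
        c (0 ⊕2* suc k) i ∎

      t-then-t : ∀ i → act t (after k) t i ≡ ℤ.- c (1 ⊕2* k) i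
      t-then-t i = begin
        after k t i ℤ.+ κ (m t t) (after k t) i
          ≡⟨ cong₂ ℤ._+_ (vt i) (≡.trans (κ-cong (m t t) vt i) (cong (λ μ → κ μ (c (1 ⊕2* k)) i) (diag t))) ⟩
        c (1 ⊕2* k) i ℤ.+ (ℤ.- c (1 ⊕2* k) i ℤ.- c (1 ⊕2* k) i)
          ≡⟨ cancel (c (1 ⊕2* k) i) ⟩
        ℤ.- c (1 ⊕2* k) i ∎

      s-value : ∀ i → after (suc k) s i ≡ ℤ.- c (0 ⊕2* suc k) i
      s-value i = begin
        act t (after k) s i ℤ.+ κ (m s s) (act t (after k) s) i
          ≡⟨ cong₂ ℤ._+_ (t-then-s i) (≡.trans (κ-cong (m s s) t-then-s i) (cong (λ μ → κ μ (c (0 ⊕2* suc k)) i) (diag s))) ⟩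
        c (0 ⊕2* suc k) i ℤ.+ (ℤ.- c (0 ⊕2* suc k) i ℤ.- c (0 ⊕2* suc k) i)
          ≡⟨ cancel (c (0 ⊕2* suc k) i) ⟩
        ℤ.- c (0 ⊕2* suc k) i ∎

      t-value : ∀ i → after (suc k) t i ≡ c (1 ⊕2* suc k) i
      t-value i = begin
        act t (after k) t i ℤ.+ κ (m s t) (act t (after k) s) i
          ≡⟨ cong₂ ℤ._+_ (t-then-t i) (≡.trans (κ-cong (m s t) t-then-s i) (cong (λ n → κ (m s t) (c (suc n)) i) (≡.sym (suc-⊕2* 0 k)))) ⟩
        ℤ.- c (1 ⊕2* k) i ℤ.+ κ (m s t) (c (suc (1 ⊕2* k))) i
          ≡⟨ swap (c (1 ⊕2* k) i) (κ (m s t) (c (suc (1 ⊕2* k))) i) ⟩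
        c (1 ⊕2* suc k) i ∎

      any-value : ∀ a i → after (suc k) a i ≡ after k a i ℤ.+ (κ (m t a) (c (1 ⊕2* k)) i ℤ.+ κ (m s a) (c (2 ⊕2* k)) i)
      any-value a i = ≡.trans
        (cong₂ (λ x y → (after k a i ℤ.+ x) ℤ.+ y)
          (κ-cong (m t a) vt i)
          (≡.trans (κ-cong (m s a) t-then-s i) (cong (λ n → κ (m s a) (c n) i) (≡.sym (⊕2*-suc 0 k)))))
        (ℤₚ.+-assoc (after k a i) (κ (m t a) (c (1 ⊕2* k)) i) (κ (m s a) (c (2 ⊕2* k)) i))

    values : ∀ k → Values k
    values zero    = (λ i → ≡.sym (ℤₚ.neg-involutive (f s i))) , (λ i → refl)
    values (suc k) = Step.s-value k (proj₁ (values k)) (proj₂ (values k)) , Step.t-value k (proj₁ (values k)) (proj₂ (values k))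

    -- Each factor st moves the coordinate at `a` by one odd and one even term of `c`. Collecting
    -- them under `κ` reduces triviality of (st)^k to the vanishing of two sums of `c`.
    total-value : ∀ k a i → after k a i ≡ f a i ℤ.+
      (κ (m t a) (λ j → sumTo k (λ n → c (1 ⊕2* n) j)) i ℤ.+ κ (m s a) (λ j → sumTo k (λ n → c (2 ⊕2* n) j)) i)
    total-value zero    a i = ≡.sym (≡.trans (cong (λ z → f a i ℤ.+ z) (cong₂ ℤ._+_ (κ-0 (m t a) i) (κ-0 (m s a) i))) (ℤₚ.+-identityʳ (f a i)))
    total-value (suc k) a i = begin
      after (suc k) a i
        ≡⟨ Step.any-value k (proj₁ (values k)) (proj₂ (values k)) a i ⟩
      after k a i ℤ.+ (T (c (1 ⊕2* k)) ℤ.+ R (c (2 ⊕2* k)))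
        ≡⟨ cong (ℤ._+ (T (c (1 ⊕2* k)) ℤ.+ R (c (2 ⊕2* k)))) (total-value k a i) ⟩
      (f a i ℤ.+ (T odd ℤ.+ R even)) ℤ.+ (T (c (1 ⊕2* k)) ℤ.+ R (c (2 ⊕2* k)))
        ≡⟨ lem (f a i) (T odd) (R even) (T (c (1 ⊕2* k))) (R (c (2 ⊕2* k))) ⟩
      f a i ℤ.+ ((T odd ℤ.+ T (c (1 ⊕2* k))) ℤ.+ (R even ℤ.+ R (c (2 ⊕2* k))))
        ≡⟨ cong (λ z → f a i ℤ.+ z) (cong₂ ℤ._+_ (≡.sym (κ-+ (m t a) odd (c (1 ⊕2* k)) i)) (≡.sym (κ-+ (m s a) even (c (2 ⊕2* k)) i))) ⟩
      f a i ℤ.+ (T (λ j → odd j ℤ.+ c (1 ⊕2* k) j) ℤ.+ R (λ j → even j ℤ.+ c (2 ⊕2* k) j)) ∎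
      where
      open ≡-Reasoning
      T R : Seq → ℤ
      T φ = κ (m t a) φ i
      R φ = κ (m s a) φ i
      odd even : Seq
      odd  j = sumTo k (λ n → c (1 ⊕2* n) j)
      even j = sumTo k (λ n → c (2 ⊕2* n) j)
      lem : ∀ a b c d e → (a ℤ.+ (b ℤ.+ c)) ℤ.+ (d ℤ.+ e) ≡ a ℤ.+ ((b ℤ.+ d) ℤ.+ (c ℤ.+ e))
      lem = solve-∀

  alt-trivial : ∀ s t k → m s t ≡ just k → ∀ f → acts (alt s t k) f ≗ f
  alt-trivial s t 0 e f a i = refl
  -- Here `s` and `t` agree only up to double negation, which suffices because equality of integers
  -- is stable.
  alt-trivial s t 1 e f a i = decidable-stable (_ ℤ.≟ _) λ ne →
    m≡1⇒¬¬≡ e λ { refl → ne (ss-trivial s a i) }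
    where
    ss-trivial : ∀ s a i → act s (act s f) a i ≡ f a i
    ss-trivial s a i = begin
      (f a i ℤ.+ κ (m s a) (f s) i) ℤ.+ κ (m s a) (act s f s) i
        ≡⟨ ℤₚ.+-assoc (f a i) _ _ ⟩
      f a i ℤ.+ (κ (m s a) (f s) i ℤ.+ κ (m s a) (act s f s) i)
        ≡⟨ cong (λ z → f a i ℤ.+ z) (≡.sym (κ-+ (m s a) (f s) (act s f s) i)) ⟩
      f a i ℤ.+ κ (m s a) (λ j → f s j ℤ.+ act s f s j) i
        ≡⟨ cong (λ z → f a i ℤ.+ z) (≡.trans (κ-cong (m s a) sum≡0 i) (κ-0 (m s a) i)) ⟩
      f a i ℤ.+ 0ℤ
        ≡⟨ ℤₚ.+-identityʳ (f a i) ⟩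
      f a i ∎
      where
      open ≡-Reasoning
      lem : ∀ x → x ℤ.+ (x ℤ.+ (ℤ.- x ℤ.- x)) ≡ 0ℤ
      lem = solve-∀
      sum≡0 : ∀ j → f s j ℤ.+ act s f s j ≡ 0ℤ
      sum≡0 j = ≡.trans (cong (λ μ → f s j ℤ.+ (f s j ℤ.+ κ μ (f s) j)) (diag s)) (lem (f s j))
  alt-trivial s t (suc (suc k)) e f a i = begin
    acts (alt s t (2 ℕ.+ k)) f a i
      ≡⟨ total-value (2 ℕ.+ k) a i ⟩
    f a i ℤ.+ (κ (m t a) (total 1) i ℤ.+ κ (m s a) (total 2) i)
      ≡⟨ cong (λ z → f a i ℤ.+ z) (cong₂ ℤ._+_ (vanish (m t a) 1) (vanish (m s a) 2)) ⟩
    f a i ℤ.+ 0ℤ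
      ≡⟨ ℤₚ.+-identityʳ (f a i) ⟩
    f a i ∎
    where
    open ≡-Reasoning
    open Alternating s t f
    total : ℕ → Seq
    total n j = sumTo (2 ℕ.+ k) (λ l → c (n ⊕2* l) j)
    vanish : ∀ μ n → κ μ (total n) i ≡ 0ℤ
    vanish μ n = ≡.trans (κ-cong μ total≡0 i) (κ-0 μ i)
      where
      total≡0 : ∀ j → total n j ≡ 0ℤ
      total≡0 j rewrite e = cheb-sum≡0 k _ _ n j

  acts-≈ : ∀ {x y} → x ≈ y → ∀ f → acts x f ≗ acts y f
  acts-≈ (rel {s} {t} {k} e a b) f p i
    rewrite acts-++ a (alt s t k ++ b) f | acts-++ a b f | acts-++ (alt s t k) b f =
    acts-cong a (alt-trivial s t k e (acts b f)) p i
  acts-≈ ≈-refl        f p i = refl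
  acts-≈ (≈-sym e)     f p i = ≡.sym (acts-≈ e f p i)
  acts-≈ (≈-trans e g) f p i = ≡.trans (acts-≈ e f p i) (acts-≈ g f p i)

  alt≉[] : ∀ s t → m s t ≢ just 1 → ∀ d → 0 < d → (∀ k → m s t ≡ just k → d < k) → ¬ (alt s t d ≈ [])
  alt≉[] s t ne d 0<d d< e with cheb-aperiodic (m s t) (m≢1⇒2≤ ne)
  ... | p , q , aperiodic = aperiodic d 0<d d< (begin
    cheb (m s t) p q (1 ⊕2* d) 0    ≡⟨ ≡.sym (cheb-cong fs ft (1 ⊕2* d) 0) ⟩
    c (1 ⊕2* d) 0                   ≡⟨ ≡.sym (proj₂ (values d) 0) ⟩
    acts (alt s t d) f t 0          ≡⟨ acts-≈ e f t 0 ⟩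
    f t 0                           ≡⟨ ft 0 ⟩
    q 0                             ∎)
    where
    open ≡-Reasoning
    -- The state needs prescribed values at `s` and `t` although generators cannot be compared; the
    -- entry `m a t` tells `t` from `s`, being 1 at `t` and different from 1 at `s`.
    select : Maybe ℕ → Seq
    select (just 1) = q
    select _        = λ i → ℤ.- p i
    f : State
    f a = select (m a t)
    open Alternating s t f
    ft : ∀ i → f t i ≡ q i
    ft i rewrite diag t = refl
    select≢1 : ∀ μ → μ ≢ just 1 → ∀ i → select μ i ≡ ℤ.- p i
    select≢1 nothing              _  i = refl
    select≢1 (just 0)             _  i = refl
    select≢1 (just 1)             ne i = contradiction refl ne
    select≢1 (just (suc (suc _))) _  i = refl
    fs : ∀ i → ℤ.- f s i ≡ p i
    fs i = ≡.trans (cong ℤ.-_ (select≢1 (m s t) ne i)) (ℤₚ.neg-involutive (p i))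
    cheb-cong : ∀ {μ p q p′ q′} → (∀ i → p i ≡ p′ i) → (∀ i → q i ≡ q′ i) → ∀ n i → cheb μ p q n i ≡ cheb μ p′ q′ n i
    cheb-cong {μ} {p} {q} {p′} {q′} ep eq n = proj₁ (both n)
      where
      both : ∀ n → (∀ i → cheb μ p q n i ≡ cheb μ p′ q′ n i) × (∀ i → cheb μ p q (suc n) i ≡ cheb μ p′ q′ (suc n) i)
      both zero = ep , eq
      both (suc n) with both n
      ... | x , y = y , λ i → cong₂ ℤ._-_ (κ-cong μ y i) (x i)

-- Lists modulo cancelling pairs.

module Mod2 (T : Setoid 0ℓ 0ℓ) where
  open Setoid T using (_≈_) renaming (Carrier to A; refl to ≈-refl; sym to ≈-sym; trans to ≈-trans)
  open PermutationSetoid T public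
  open PermutationSetoidProperties T
  open MembershipSetoid T using (_∈_) public

  dbl : List A → List A
  dbl []       = []
  dbl (x ∷ xs) = x ∷ x ∷ dbl xs

  dbl-++ : ∀ xs ys → dbl (xs ++ ys) ≡ dbl xs ++ dbl ys
  dbl-++ []       ys = refl
  dbl-++ (x ∷ xs) ys = cong (λ zs → x ∷ x ∷ zs) (dbl-++ xs ys)

  dbl-↭ : ∀ xs → dbl xs ↭ xs ++ xs
  dbl-↭ []       = ↭-refl
  dbl-↭ (x ∷ xs) = ↭-prep x (↭-trans (↭-prep x (dbl-↭ xs)) (↭-sym (↭-shift xs xs)))

  -- Equality in the free 𝔽₂-module on T.  Since _≈_ need not be decidable, it is witnessed
  -- by the cancelling pairs added on both sides.
  infix 4 _∼_
  _∼_ : List A → List A → Set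
  xs ∼ ys = Σ (List A) λ P → Σ (List A) λ Q → xs ++ dbl P ↭ ys ++ dbl Q

  ↭⇒∼ : ∀ {xs ys} → xs ↭ ys → xs ∼ ys
  ↭⇒∼ p = [] , [] , ++⁺ʳ [] p

  ∼-sym : ∀ {xs ys} → xs ∼ ys → ys ∼ xs
  ∼-sym (P , Q , p) = Q , P , ↭-sym p

  ∼-trans : ∀ {xs ys zs} → xs ∼ ys → ys ∼ zs → xs ∼ zs
  ∼-trans {xs} {ys} {zs} (P , Q , p) (P′ , Q′ , p′) = P ++ P′ , Q′ ++ Q , (begin
    xs ++ dbl (P ++ P′)         ≡⟨ cong (xs ++_) (dbl-++ P P′) ⟩
    xs ++ dbl P ++ dbl P′       ≡⟨ ≡.sym (Listₚ.++-assoc xs (dbl P) (dbl P′)) ⟩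
    (xs ++ dbl P) ++ dbl P′     ↭⟨ ++⁺ʳ (dbl P′) p ⟩
    (ys ++ dbl Q) ++ dbl P′     ≡⟨ Listₚ.++-assoc ys (dbl Q) (dbl P′) ⟩
    ys ++ dbl Q ++ dbl P′       ↭⟨ ++⁺ˡ ys (++-comm (dbl Q) (dbl P′)) ⟩
    ys ++ dbl P′ ++ dbl Q       ≡⟨ ≡.sym (Listₚ.++-assoc ys (dbl P′) (dbl Q)) ⟩
    (ys ++ dbl P′) ++ dbl Q     ↭⟨ ++⁺ʳ (dbl Q) p′ ⟩
    (zs ++ dbl Q′) ++ dbl Q     ≡⟨ Listₚ.++-assoc zs (dbl Q′) (dbl Q) ⟩
    zs ++ dbl Q′ ++ dbl Q       ≡⟨ cong (zs ++_) (≡.sym (dbl-++ Q′ Q)) ⟩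
    zs ++ dbl (Q′ ++ Q)         ∎)
    where open PermutationReasoning

  ∼-∷ : ∀ x {xs ys} → xs ∼ ys → (x ∷ xs) ∼ (x ∷ ys)
  ∼-∷ x (P , Q , p) = P , Q , ↭-prep x p

  dbl-map : ∀ (f : A → A) xs → dbl (map f xs) ≡ map f (dbl xs)
  dbl-map f []       = refl
  dbl-map f (x ∷ xs) = cong (λ zs → f x ∷ f x ∷ zs) (dbl-map f xs)

  ∼-map : ∀ (f : A → A) → (∀ {x y} → x ≈ y → f x ≈ f y) → ∀ {xs ys} → xs ∼ ys → map f xs ∼ map f ys
  ∼-map f f-cong {xs} {ys} (P , Q , p) = map f P , map f Q ,
    ≡.subst₂ _↭_ (eq xs P) (eq ys Q) (map⁺ T f-cong p)
    where
    eq : ∀ xs P → map f (xs ++ dbl P) ≡ map f xs ++ dbl (map f P)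
    eq xs P = ≡.trans (Listₚ.map-++ f xs (dbl P)) (cong (map f xs ++_) (≡.sym (dbl-map f P)))

  ∼-drop-square : ∀ {xs ys zs} → xs ↭ ys ++ ys → xs ++ zs ∼ zs
  ∼-drop-square {xs} {ys} {zs} p = [] , ys , (begin
    (xs ++ zs) ++ []     ≡⟨ Listₚ.++-identityʳ (xs ++ zs) ⟩
    xs ++ zs             ↭⟨ ++⁺ʳ zs p ⟩
    (ys ++ ys) ++ zs     ↭⟨ ++-comm (ys ++ ys) zs ⟩
    zs ++ (ys ++ ys)     ↭⟨ ++⁺ˡ zs (↭-sym (dbl-↭ ys)) ⟩
    zs ++ dbl ys         ∎)
    where open PermutationReasoning

  data Repeats : List A → Set where
    here  : ∀ {x xs} → x ∈ xs → Repeats (x ∷ xs)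
    there : ∀ {x xs} → Repeats xs → Repeats (x ∷ xs)

  ∈-resp : ∀ {x y xs} → x ≈ y → x ∈ xs → y ∈ xs
  ∈-resp e = Any.map (≈-trans (≈-sym e))

  Repeats-resp-Pointwise : ∀ {xs ys} → Pointwise _≈_ xs ys → Repeats xs → Repeats ys
  Repeats-resp-Pointwise (e ∷ es) (here x∈)  = here (∈-resp e (∈-resp-↭ (refl es) x∈))
  Repeats-resp-Pointwise (e ∷ es) (there d) = there (Repeats-resp-Pointwise es d)

  Repeats-resp-↭ : ∀ {xs ys} → xs ↭ ys → Repeats xs → Repeats ys
  Repeats-resp-↭ (refl es)     d                       = Repeats-resp-Pointwise es d
  Repeats-resp-↭ (prep e p)    (here x∈)               = here (∈-resp e (∈-resp-↭ p x∈))
  Repeats-resp-↭ (prep e p)    (there d)               = there (Repeats-resp-↭ p d)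
  Repeats-resp-↭ (swap e e′ p) (here (here x≈y))       = here (here (≈-trans (≈-sym e′) (≈-trans (≈-sym x≈y) e)))
  Repeats-resp-↭ (swap e e′ p) (here (there x∈))       = there (here (∈-resp e (∈-resp-↭ p x∈)))
  Repeats-resp-↭ (swap e e′ p) (there (here y∈))       = here (there (∈-resp e′ (∈-resp-↭ p y∈)))
  Repeats-resp-↭ (swap e e′ p) (there (there d))       = there (there (Repeats-resp-↭ p d))
  Repeats-resp-↭ (trans p q)   d                       = Repeats-resp-↭ q (Repeats-resp-↭ p d)

  ∈⇒↭ : ∀ {x xs} → x ∈ xs → Σ (List A) λ ys → xs ↭ x ∷ ys
  ∈⇒↭ (here e) = _ , prep (≈-sym e) ↭-refl
  ∈⇒↭ {x} {y ∷ xs} (there x∈) with ∈⇒↭ x∈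
  ... | ys , p = y ∷ ys , ↭-trans (↭-prep y p) (↭-swap y x ↭-refl)

  ∈-dbl⇒↭ : ∀ {x} Q → x ∈ dbl Q → Σ (List A) λ Q′ → dbl Q ↭ x ∷ x ∷ dbl Q′
  ∈-dbl⇒↭ (q ∷ Q) (here e)          = Q , prep (≈-sym e) (prep (≈-sym e) ↭-refl)
  ∈-dbl⇒↭ (q ∷ Q) (there (here e))  = Q , prep (≈-sym e) (prep (≈-sym e) ↭-refl)
  ∈-dbl⇒↭ {x} (q ∷ Q) (there (there x∈)) with ∈-dbl⇒↭ Q x∈
  ... | Q′ , p = q ∷ Q′ , ↭-trans (++⁺ˡ (q ∷ q ∷ []) p) (shifts (q ∷ q ∷ []) (x ∷ x ∷ []))

  -- The pairs in `P` are cancelled one by one against `ys` and `Q`, and `ys` never grows. Once `P`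
  -- is empty, a pair left in `Q` must occur in `xs`; if none is left, the lengths contradict each
  -- other.
  ∼-shorter⇒Repeats : ∀ {xs ys} → xs ∼ ys → length ys < length xs → Repeats xs
  ∼-shorter⇒Repeats {xs} {ys} (P , Q , p) = go P Q ys p
    where
    open PermutationReasoning
    go : ∀ P Q ys → xs ++ dbl P ↭ ys ++ dbl Q → length ys < length xs → Repeats xs
    go [] [] ys p ys<xs = contradiction (xs↭ys⇒|xs|≡|ys| (≡.subst₂ _↭_ (Listₚ.++-identityʳ xs) (Listₚ.++-identityʳ ys) p))
                                        (λ eq → ℕₚ.<-irrefl (≡.sym eq) ys<xs)
    go [] (q ∷ Q) ys p _ = Repeats-resp-↭ (begin
      q ∷ q ∷ ys ++ dbl Q   ↭⟨ shifts (q ∷ q ∷ []) ys ⟩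
      ys ++ dbl (q ∷ Q)     ↭⟨ ↭-sym p ⟩
      xs ++ []              ≡⟨ Listₚ.++-identityʳ xs ⟩
      xs                    ∎) (here (here ≈-refl))
    go (r ∷ P) Q ys p ys<xs = cases (Anyₚ.++⁻ ys (∈-resp-↭ p₂ (here ≈-refl)))
      where
      p₂ : r ∷ r ∷ xs ++ dbl P ↭ ys ++ dbl Q
      p₂ = ↭-trans (shifts (r ∷ r ∷ []) xs) p
      cases : r ∈ ys ⊎ r ∈ dbl Q → Repeats xs
      cases (inj₂ r∈Q) with ∈-dbl⇒↭ Q r∈Q
      ... | Q′ , q = go P Q′ ys (drop-∷ (drop-∷ (begin
        r ∷ r ∷ xs ++ dbl P     ↭⟨ p₂ ⟩
        ys ++ dbl Q             ↭⟨ ++⁺ˡ ys q ⟩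
        ys ++ r ∷ r ∷ dbl Q′    ↭⟨ shifts ys (r ∷ r ∷ []) ⟩
        r ∷ r ∷ ys ++ dbl Q′    ∎))) ys<xs
      cases (inj₁ r∈ys) with ∈⇒↭ r∈ys
      ... | ys₁ , q = cases₁ (Anyₚ.++⁻ ys₁ (∈-resp-↭ p₁ (here ≈-refl)))
        where
        |ys₁|≤ : suc (length ys₁) ≤ length ys
        |ys₁|≤ = ℕₚ.≤-reflexive (≡.sym (xs↭ys⇒|xs|≡|ys| q))
        p₁ : r ∷ xs ++ dbl P ↭ ys₁ ++ dbl Q
        p₁ = drop-∷ (↭-trans p₂ (++⁺ʳ (dbl Q) q))
        cases₁ : r ∈ ys₁ ⊎ r ∈ dbl Q → Repeats xs
        -- One copy of `r` cancels against `ys`, the other against half of a pair in `Q`; the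
        -- remaining half takes the vacated place in `ys`.
        cases₁ (inj₂ r∈Q) with ∈-dbl⇒↭ Q r∈Q
        ... | Q′ , q′ = go P Q′ (r ∷ ys₁) (drop-∷ (begin
          r ∷ xs ++ dbl P         ↭⟨ p₁ ⟩
          ys₁ ++ dbl Q            ↭⟨ ++⁺ˡ ys₁ q′ ⟩
          ys₁ ++ r ∷ r ∷ dbl Q′   ↭⟨ shifts ys₁ (r ∷ r ∷ []) ⟩
          r ∷ r ∷ ys₁ ++ dbl Q′   ∎)) (ℕₚ.≤-<-trans |ys₁|≤ ys<xs)
        cases₁ (inj₁ r∈ys₁) with ∈⇒↭ r∈ys₁
        ... | ys₂ , q′ = go P Q ys₂ (drop-∷ (↭-trans p₁ (++⁺ʳ (dbl Q) q′)))
              (ℕₚ.≤-<-trans (ℕₚ.≤-trans (ℕₚ.n≤1+n _) (ℕₚ.≤-trans (ℕₚ.≤-reflexive (≡.sym (xs↭ys⇒|xs|≡|ys| q′))) (ℕₚ.≤-trans (ℕₚ.n≤1+n _) |ys₁|≤))) ys<xs)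

-- Reflections of a word and the exchange condition.

module Reflections (C : CoxeterMatrix) where
  open Basics C
  open Mod2 W-setoid
  open PermutationSetoidProperties W-setoid using (++⁺ˡ; ++⁺ʳ)

  conj : S → Word → Word
  conj s x = s ∷ x ++ [ s ]

  conjs : Word → Word → Word
  conjs []      x = x
  conjs (s ∷ w) x = conj s (conjs w x)

  conj-cong : ∀ s {x y} → x ≈ y → conj s x ≈ conj s y
  conj-cong s e = ∷-cong s (++-congʳ [ s ] e)

  conj-++ : ∀ s x w → (conj s x ++ s ∷ w) ≈ (s ∷ x ++ w)
  conj-++ s x w = ∷-cong s (≈-trans (≈-reflexive (Listₚ.++-assoc x [ s ] (s ∷ w))) (++-congˡ x (ss≈ s w)))

  conj-involutive : ∀ s x → conj s (conj s x) ≈ x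
  conj-involutive s x = ≈-trans
    (≈-reflexive (cong (λ y → s ∷ s ∷ y) (Listₚ.++-assoc x [ s ] [ s ])))
    (≈-trans (ss≈ s _) (≈-trans (++-congˡ x (ss≈ s [])) (≈-reflexive (Listₚ.++-identityʳ x))))

  conj-flip : ∀ s {x y} → x ≈ conj s y → conj s x ≈ y
  conj-flip s e = ≈-trans (conj-cong s e) (conj-involutive s _)

  conj-fix : ∀ {s y} → [ s ] ≈ conj s y → [ s ] ≈ y
  conj-fix {s} e = ≈-trans (≈-sym (ss≈ s [ s ])) (conj-flip s e)

  conjs-++ : ∀ a x → (conjs a x ++ a) ≈ (a ++ x)
  conjs-++ []      x = ≈-reflexive (Listₚ.++-identityʳ x)
  conjs-++ (s ∷ a) x = ≈-trans (conj-++ s (conjs a x) a) (∷-cong s (conjs-++ a x))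

  -- The reflections s₁ ⋯ sᵢ ⋯ s₁ attached to the letters of s₁ ⋯ sₖ; left multiplication
  -- by the i-th one deletes the i-th letter.
  N : Word → List Word
  N []      = []
  N (s ∷ w) = [ s ] ∷ map (conj s) (N w)

  length-N : ∀ w → length (N w) ≡ length w
  length-N []      = refl
  length-N (s ∷ w) = cong suc (≡.trans (Listₚ.length-map (conj s) (N w)) (length-N w))

  N-++ : ∀ x y → N (x ++ y) ≡ N x ++ map (conjs x) (N y)
  N-++ []      y = ≡.sym (Listₚ.map-id (N y))
  N-++ (s ∷ x) y = cong ([ s ] ∷_) (begin
    map (conj s) (N (x ++ y))                              ≡⟨ cong (map (conj s)) (N-++ x y) ⟩
    map (conj s) (N x ++ map (conjs x) (N y))              ≡⟨ Listₚ.map-++ (conj s) (N x) _ ⟩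
    map (conj s) (N x) ++ map (conj s) (map (conjs x) (N y)) ≡⟨ cong (map (conj s) (N x) ++_) (≡.sym (Listₚ.map-∘ (N y))) ⟩
    map (conj s) (N x) ++ map (conjs (s ∷ x)) (N y)        ∎)
    where open ≡-Reasoning

  altw : S → S → ℕ → Word
  altw s t zero    = []
  altw s t (suc n) = s ∷ altw t s n

  alt≡altw : ∀ s t k → alt s t k ≡ altw s t (0 ⊕2* k)
  alt≡altw s t zero    = refl
  alt≡altw s t (suc k) = cong (λ w → s ∷ t ∷ w) (alt≡altw s t k)

  altw-snoc : ∀ s t i → altw s t (1 ⊕2* i) ++ [ t ] ≡ altw s t (suc (1 ⊕2* i))
  altw-snoc s t zero    = refl
  altw-snoc s t (suc i) = cong (λ w → s ∷ t ∷ w) (altw-snoc s t i)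

  N-altw : ∀ s t n → N (altw s t n) ≡ applyUpTo (λ i → altw s t (1 ⊕2* i)) n
  N-altw s t zero    = refl
  N-altw s t (suc n) = cong ([ s ] ∷_) (begin
    map (conj s) (N (altw t s n))                              ≡⟨ cong (map (conj s)) (N-altw t s n) ⟩
    map (conj s) (applyUpTo (λ i → altw t s (1 ⊕2* i)) n)      ≡⟨ Listₚ.map-applyUpTo _ (conj s) n ⟩
    applyUpTo (λ i → conj s (altw t s (1 ⊕2* i))) n            ≡⟨ applyUpTo-cong n (λ i → cong (s ∷_) (altw-snoc t s i)) ⟩
    applyUpTo (λ i → altw s t (1 ⊕2* suc i)) n                 ∎)
    where
    open ≡-Reasoning
    applyUpTo-cong : ∀ {f g : ℕ → Word} n → (∀ i → f i ≡ g i) → applyUpTo f n ≡ applyUpTo g n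
    applyUpTo-cong zero    e = refl
    applyUpTo-cong (suc n) e = cong₂ _∷_ (e 0) (applyUpTo-cong n (λ i → e (suc i)))

  altw-period : ∀ s t k i → altw s t (1 ⊕2* (k ℕ.+ i)) ≡ alt s t k ++ altw s t (1 ⊕2* i)
  altw-period s t zero    i = refl
  altw-period s t (suc k) i = cong (λ w → s ∷ t ∷ w) (altw-period s t k i)

  -- The reflections of (st)^k are the alternating words of odd length below 4k; the relation
  -- identifies the i-th with the (k + i)-th, so the second half repeats the first.
  N-alt-square : ∀ {s t k} → m s t ≡ just k → Σ (List Word) λ H → N (alt s t k) ↭ H ++ H
  N-alt-square {s} {t} {k} e = applyUpTo r k , (begin
    N (alt s t k)                                      ≡⟨ cong N (alt≡altw s t k) ⟩
    N (altw s t (0 ⊕2* k))                             ≡⟨ N-altw s t (0 ⊕2* k) ⟩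
    applyUpTo r (0 ⊕2* k)                              ≡⟨ cong (applyUpTo r) (0⊕2* k) ⟩
    applyUpTo r (k ℕ.+ k)                              ≡⟨ applyUpTo-+ r k k ⟩
    applyUpTo r k ++ applyUpTo (λ i → r (k ℕ.+ i)) k   ↭⟨ ++⁺ˡ (applyUpTo r k) (refl (applyUpTo-≋ k periodic)) ⟩
    applyUpTo r k ++ applyUpTo r k                     ∎)
    where
    open PermutationReasoning
    r : ℕ → Word
    r i = altw s t (1 ⊕2* i)
    applyUpTo-+ : ∀ (f : ℕ → Word) a b → applyUpTo f (a ℕ.+ b) ≡ applyUpTo f a ++ applyUpTo (λ i → f (a ℕ.+ i)) b
    applyUpTo-+ f zero    b = refl
    applyUpTo-+ f (suc a) b = cong (f 0 ∷_) (applyUpTo-+ (λ i → f (suc i)) a b)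
    applyUpTo-≋ : ∀ {f g : ℕ → Word} n → (∀ i → f i ≈ g i) → Pointwise _≈_ (applyUpTo f n) (applyUpTo g n)
    applyUpTo-≋ zero    e = []
    applyUpTo-≋ (suc n) e = e 0 ∷ applyUpTo-≋ n (λ i → e (suc i))
    periodic : ∀ i → r (k ℕ.+ i) ≈ r i
    periodic i = ≈-trans (≈-reflexive (altw-period s t k i)) (rel e [] (r i))

  -- By `N-++`, a relator contributes a doubled list and conjugates the later reflections by a
  -- trivial element. So `N` modulo pairs is an invariant of the group element.
  N-resp-∼ : ∀ {x y} → x ≈ y → N x ∼ N y
  N-resp-∼ (rel {s} {t} {k} e a b) = go a
    where
    conj-trivial : ∀ x → conjs (alt s t k) x ≈ x
    conj-trivial x = ≈-trans (≈-reflexive (≡.sym (Listₚ.++-identityʳ _)))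
      (≈-trans (++-congˡ (conjs (alt s t k) x) (≈-sym alt≈[])) (≈-trans (conjs-++ (alt s t k) x) (rel e [] x)))
      where
      alt≈[] : alt s t k ≈ []
      alt≈[] = ≡.subst (_≈ []) (Listₚ.++-identityʳ (alt s t k)) (rel e [] [])
    map-≋ : ∀ xs → Pointwise _≈_ (map (conjs (alt s t k)) xs) xs
    map-≋ []       = []
    map-≋ (x ∷ xs) = conj-trivial x ∷ map-≋ xs
    go : ∀ a → N (a ++ alt s t k ++ b) ∼ N (a ++ b)
    go (r ∷ a) = ∼-∷ [ r ] (∼-map (conj r) (conj-cong r) (go a))
    go [] rewrite N-++ (alt s t k) b = ∼-trans
      (↭⇒∼ (++⁺ˡ (N (alt s t k)) (refl (map-≋ (N b)))))
      (∼-drop-square {ys = proj₁ (N-alt-square e)} (proj₂ (N-alt-square e)))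
  N-resp-∼ ≈-refl        = ↭⇒∼ ↭-refl
  N-resp-∼ (≈-sym e)     = ∼-sym (N-resp-∼ e)
  N-resp-∼ (≈-trans e f) = ∼-trans (N-resp-∼ e) (N-resp-∼ f)

  data Del : Word → Word → Set where
    here  : ∀ {s w} → Del w (s ∷ w)
    there : ∀ {s w′ w} → Del w′ w → Del (s ∷ w′) (s ∷ w)

  Del-length : ∀ {w′ w} → Del w′ w → length w ≡ suc (length w′)
  Del-length here      = refl
  Del-length (there d) = cong suc (Del-length d)

  ∈-N⇒Del : ∀ {x} w → x ∈ N w → Σ Word λ w′ → Del w′ w × (x ++ w) ≈ w′
  ∈-N⇒Del (s ∷ w) (here x≈s) = w , here , ≈-trans (++-congʳ (s ∷ w) x≈s) (ss≈ s w)
  ∈-N⇒Del {x} (s ∷ w) (there x∈) with ∈-N⇒Del w (Any.map (conj-flip s) (Anyₚ.map⁻ x∈))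
  ... | w′ , d , e = s ∷ w′ , there d , 
    ≈-trans (++-congʳ (s ∷ w) (≈-sym (conj-involutive s x))) (≈-trans (conj-++ s (conj s x) w) (∷-cong s e))

  Repeats-map⁻ : ∀ s xs → Repeats (map (conj s) xs) → Repeats xs
  Repeats-map⁻ s (x ∷ xs) (here x∈)  = here (Any.map (λ e → ≈-trans (≈-sym (conj-involutive s x)) (conj-flip s e)) (Anyₚ.map⁻ x∈))
  Repeats-map⁻ s (x ∷ xs) (there d) = there (Repeats-map⁻ s xs d)

  -- Multiplying twice by the repeated reflection changes nothing in the group, but deletes two
  -- different letters.
  Repeats-N⇒shorter : ∀ w → Repeats (N w) → Σ Word λ w′ → w ≈ w′ × length w′ < length w
  Repeats-N⇒shorter (s ∷ w) (here s∈) with ∈-N⇒Del w (Any.map conj-fix (Anyₚ.map⁻ s∈))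
  ... | w′ , d , e = w′ , e , ℕₚ.≤-trans (ℕₚ.≤-reflexive (≡.sym (Del-length d))) (ℕₚ.n≤1+n _)
  Repeats-N⇒shorter (s ∷ w) (there r) with Repeats-N⇒shorter w (Repeats-map⁻ s (N w) r)
  ... | w′ , e , l = s ∷ w′ , ∷-cong s e , s≤s l

  -- The shorter word `b` forces a repetition among the reflections of `s ∷ w`. It cannot lie inside
  -- reduced `w`, so it involves the first letter, and `[ s ]` is a reflection of `w`.
  exchange : ∀ {s w b} → Reduced w → b ≈ (s ∷ w) → length b < suc (length w) →
             Σ Word λ w′ → Del w′ w × (s ∷ w) ≈ w′
  exchange {s} {w} {b} red e b< with ∼-shorter⇒Repeats (N-resp-∼ (≈-sym e)) (≡.subst₂ _<_ (≡.sym (length-N b)) (≡.sym (length-N (s ∷ w))) b<)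
  ... | here s∈ = ∈-N⇒Del w (Any.map conj-fix (Anyₚ.map⁻ s∈))
  ... | there r with Repeats-N⇒shorter w (Repeats-map⁻ s (N w) r)
  ...   | w′ , e′ , l = contradiction (red w′ (≈-sym e′)) (ℕₚ.<⇒≱ l)

-- Deciding descents and equality in the group.

module Descents (C : CoxeterMatrix) where
  open Basics C
  open Representation C using (alt≉[])
  open Reflections C
  open Mod2 W-setoid using (Repeats; here; there; ∼-shorter⇒Repeats; ∼-sym)

  Reduced-tail : ∀ {s w} → Reduced (s ∷ w) → Reduced w
  Reduced-tail {s} red b e = ℕₚ.≤-pred (red (s ∷ b) (∷-cong s e))

  Reduced-resp : ∀ {x y} → Reduced x → y ≈ x → length y ≡ length x → Reduced y
  Reduced-resp red e l b f = ℕₚ.≤-trans (ℕₚ.≤-reflexive l) (red b (≈-trans f e))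

  -- For a reduced word w, this says that s is a left descent of w.
  Head : S → Word → Set
  Head s w = Σ Word λ w′ → (s ∷ w′) ≈ w × length w ≡ suc (length w′)

  Head-Reduced : ∀ {s w} → Reduced w → (h : Head s w) → Reduced (proj₁ h)
  Head-Reduced red (w′ , e , l) = Reduced-tail (Reduced-resp red e (≡.sym l))

  ¬Head⇒Reduced : ∀ {s w} → Reduced w → ¬ Head s w → Reduced (s ∷ w)
  ¬Head⇒Reduced {s} {w} red ¬h b e with suc (length w) ℕ.≤? length b
  ... | yes p = p
  ... | no ¬p with exchange red e (ℕₚ.≰⇒> ¬p)
  ...   | w′ , d , f = contradiction (w′ , ≈-sym (flip-∷ f) , Del-length d) ¬h

  Begins : S → S → ℕ → Word → Set
  Begins s t n w = Σ Word λ v → (altw s t n ++ v) ≈ w × length w ≡ n ℕ.+ length v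

  length-altw : ∀ s t n → length (altw s t n) ≡ n
  length-altw s t zero    = refl
  length-altw s t (suc n) = cong suc (length-altw t s n)

  length-altw-++ : ∀ s t n v → length (altw s t n ++ v) ≡ n ℕ.+ length v
  length-altw-++ s t n v = ≡.trans (Listₚ.length-++ (altw s t n)) (cong (ℕ._+ length v) (length-altw s t n))

  Repeats-applyUpTo : ∀ (f : ℕ → Word) n → Repeats (applyUpTo f n) →
    Σ ℕ λ i → Σ ℕ λ d → suc d ℕ.+ i < n × f i ≈ f (suc d ℕ.+ i)
  Repeats-applyUpTo f (suc n) (here x∈) with Anyₚ.applyUpTo⁻ (λ i → f (suc i)) x∈
  ... | d , d<n , e rewrite ≡.sym (ℕₚ.+-identityʳ d) = 0 , d , s≤s d<n , e
  Repeats-applyUpTo f (suc n) (there r) with Repeats-applyUpTo (λ i → f (suc i)) n r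
  ... | i , d , l , e = suc i , d , ≡.subst (_< suc n) (cong suc (≡.sym (ℕₚ.+-suc d i))) (s≤s l)
                                  , ≡.subst (λ j → f (suc i) ≈ f (suc j)) (≡.sym (ℕₚ.+-suc d i)) e

  -- A shorter expression would make two of the reflections coincide, hence a power of st with
  -- positive exponent below `m s t` trivial, against `alt≉[]`.
  altw-shortest : ∀ {s t n b} → m s t ≢ just 1 → (∀ k → m s t ≡ just k → n ≤ k) →
                  altw s t n ≈ b → ¬ length b < n
  altw-shortest {s} {t} {n} {b} ne n≤ e l
    with Repeats-applyUpTo _ n (≡.subst Repeats (N-altw s t n) (∼-shorter⇒Repeats (N-resp-∼ e)
           (≡.subst₂ _<_ (≡.sym (length-N b)) (≡.sym (≡.trans (length-N (altw s t n)) (length-altw s t n))) l)))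
  ... | i , d , d+i<n , f = alt≉[] s t ne (suc d) (s≤s z≤n)
          (λ k eq → ℕₚ.<-≤-trans (ℕₚ.≤-<-trans (ℕₚ.m≤m+n (suc d) i) d+i<n) (n≤ k eq))
          (≈-sym (∙-cancelʳ (altw s t (1 ⊕2* i)) _ _ (≈-trans f (≈-reflexive (altw-period s t (suc d) i)))))

  Del-++ : ∀ a {v x} → Del x (a ++ v) →
    (Σ Word λ a′ → Del a′ a × x ≡ a′ ++ v) ⊎ (Σ Word λ v′ → Del v′ v × x ≡ a ++ v′)
  Del-++ []      d         = inj₂ (_ , d , refl)
  Del-++ (s ∷ a) here      = inj₁ (a , here , refl)
  Del-++ (s ∷ a) (there d) with Del-++ a d
  ... | inj₁ (a′ , d′ , refl) = inj₁ (s ∷ a′ , there d′ , refl)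
  ... | inj₂ (v′ , d′ , refl) = inj₂ (v′ , d′ , refl)

  -- Exchange by `t` deletes a letter of `altw s t n ++ v`. A deletion in `v` gives the longer
  -- beginning; one in the prefix would write `altw t s (suc n)` with n - 1 letters, against
  -- `altw-shortest`.
  extend : ∀ {s t n w} → Reduced w → m t s ≢ just 1 → (∀ k → m t s ≡ just k → suc n ≤ k) →
           Head t w → Begins s t n w → Begins t s (suc n) w
  extend {s} {t} {n} {w} red ne n≤ (w₁ , e₁ , l₁) (v , e , l)
    with exchange {t} {altw s t n ++ v} {w₁}
           (Reduced-resp red e (≡.trans (length-altw-++ s t n v) (≡.sym l)))
           (≈-trans (≈-trans (≈-sym (ss≈ t w₁)) (∷-cong t e₁)) (∷-cong t (≈-sym e)))
           (s≤s (ℕₚ.≤-trans (ℕₚ.n≤1+n _) (ℕₚ.≤-reflexive (≡.trans (≡.sym l₁) (≡.trans l (≡.sym (length-altw-++ s t n v)))))))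
  ... | x , d , f with Del-++ (altw s t n) d
  ...   | inj₂ (v′ , d′ , refl) = v′ , ≈-trans (≈-sym (flip-∷ f)) e ,
            ≡.trans l (≡.trans (cong (n ℕ.+_) (Del-length d′)) (ℕₚ.+-suc n (length v′)))
  ...   | inj₁ (a′ , d′ , refl) = contradiction
            (s≤s (ℕₚ.≤-trans (ℕₚ.n≤1+n _) (ℕₚ.≤-reflexive (≡.trans (≡.sym (Del-length d′)) (length-altw s t n)))))
            (altw-shortest {t} {s} {suc n} ne n≤ (∙-cancelʳ v (t ∷ altw s t n) a′ f))

  -- Both orders are carried along because each `extend` turns a beginning with one generator into a
  -- longer beginning with the other.
  dihedral : ∀ {s t w} → Reduced w → m s t ≢ just 1 → Head s w → Head t w →
             ∀ n → (∀ k → m s t ≡ just k → n ≤ k) → Begins s t n w × Begins t s n w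
  dihedral {w = w} red ne hs ht zero n≤ = (w , ≈-refl , refl) , (w , ≈-refl , refl)
  dihedral {s} {t} red ne hs ht (suc n) n≤ with dihedral red ne hs ht n (λ k e → ℕₚ.<⇒≤ (n≤ k e))
  ... | bs , bt = extend red ne n≤ hs bt
                , extend red (λ e → ne (≡.trans (m-sym s t) e)) (λ k e → n≤ k (≡.trans (m-sym s t) e)) ht bs

  altw-++-reverse : ∀ s t k → altw s t k ++ reverse (altw t s k) ≡ alt s t k
  altw-++-reverse s t k = ≡.trans (go s t k) (≡.sym (alt≡altw s t k))
    where
    open ≡-Reasoning
    snoc : ∀ s t k → altw s t (0 ⊕2* k) ++ [ s ] ≡ altw s t (suc (0 ⊕2* k))
    snoc s t zero    = refl
    snoc s t (suc k) = cong (λ w → s ∷ t ∷ w) (snoc s t k)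
    go : ∀ s t k → altw s t k ++ reverse (altw t s k) ≡ altw s t (0 ⊕2* k)
    go s t zero    = refl
    go s t (suc k) = cong (s ∷_) (begin
      altw t s k ++ reverse (t ∷ altw s t k)       ≡⟨ cong (altw t s k ++_) (Listₚ.unfold-reverse t (altw s t k)) ⟩
      altw t s k ++ reverse (altw s t k) ++ [ t ]  ≡⟨ ≡.sym (Listₚ.++-assoc (altw t s k) _ _) ⟩
      (altw t s k ++ reverse (altw s t k)) ++ [ t ] ≡⟨ cong (_++ [ t ]) (go t s k) ⟩
      altw t s (0 ⊕2* k) ++ [ t ]                  ≡⟨ snoc t s k ⟩
      altw t s (suc (0 ⊕2* k))                     ∎)

  -- One side times the inverse of the other spells (st)^k.
  braid : ∀ {s t k} → m s t ≡ just k → altw s t k ≈ altw t s k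
  braid {s} {t} {k} e = ∙-cancelʳ (reverse (altw t s k)) _ _
    (≈-trans (≈-reflexive (altw-++-reverse s t k))
    (≈-trans (≡.subst (_≈ []) (Listₚ.++-identityʳ (alt s t k)) (rel e [] []))
             (≈-sym (inverseʳ (altw t s k)))))

  module Decide (n : ℕ) (head? : ∀ w → Reduced w → length w ≤ n → ∀ s → Dec (Head s w)) where

    begins? : ∀ k s t w → Reduced w → length w ≤ n → Dec (Begins s t k w)
    begins? zero    s t w red l = yes (w , ≈-refl , refl)
    begins? (suc k) s t w red l with head? w red l s
    ... | no ¬h = no λ { (v , e , l′) → ¬h (altw t s k ++ v , e , ≡.trans l′ (cong suc (≡.sym (length-altw-++ t s k v)))) }
    ... | yes h@(w′ , e , l′) with begins? k t s w′ (Head-Reduced red h)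
                                   (ℕₚ.≤-trans (ℕₚ.n≤1+n _) (ℕₚ.≤-trans (ℕₚ.≤-reflexive (≡.sym l′)) l))
    ...   | yes (v , f , l″) = yes (v , ≈-trans (∷-cong s f) e , ≡.trans l′ (cong suc l″))
    ...   | no ¬b = no λ { (v , f , l″) → ¬b (v , ∷-cancel s (≈-trans f (≈-sym e)) , ℕₚ.suc-injective (≡.trans (≡.sym l′) l″)) }

    head?-step : ∀ t w → Reduced (t ∷ w) → length w ≤ n → ∀ s → Dec (Head s (t ∷ w))
    head?-step t w red l s with ≡-dec ℕ._≟_ (m s t) (just 1)
    ... | yes e = yes (w , ++-congʳ w (m≡1⇒≈ e) , refl)
    ... | no ne = go (m s t) refl
      where
      go : ∀ μ → m s t ≡ μ → Dec (Head s (t ∷ w))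
      -- Without a relation the alternating beginnings have unbounded length; `2 + length w` already
      -- exceeds the length of `t ∷ w`.
      go nothing eq = no λ h → impossible (proj₁ (dihedral red ne h (w , ≈-refl , refl) (2 ℕ.+ length w)
                                                  (λ k e → contradiction (≡.trans (≡.sym eq) e) λ ())))
        where
        impossible : ¬ Begins s t (2 ℕ.+ length w) (t ∷ w)
        impossible (v , _ , l) = ℕₚ.<-irrefl l (s≤s (s≤s (ℕₚ.m≤m+n (length w) (length v))))
      go (just zero) eq = contradiction (m≢1⇒2≤ ne 0 eq) λ ()
      -- By `dihedral` and `braid`, `s` is a descent of `t ∷ w` exactly when `w` begins with
      -- `altw s t k`, which concerns the shorter word only.
      go (just (suc k)) eq with begins? k s t w (Reduced-tail red) l
      ... | yes (v , e , l′) = yes (altw t s k ++ v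
                                   , ≈-trans (++-congʳ v (braid eq)) (∷-cong t e)
                                   , cong suc (≡.trans l′ (≡.sym (length-altw-++ t s k v))))
      ... | no ¬b = no λ h → shorten (proj₂ (dihedral red ne h (w , ≈-refl , refl) (suc k)
                                              (λ k′ e → ℕₚ.≤-reflexive (just-injective (≡.trans (≡.sym eq) e)))))
        where
        shorten : ¬ Begins t s (suc k) (t ∷ w)
        shorten (v , e , l′) = ¬b (v , ∷-cancel t e , ℕₚ.suc-injective l′)

  head?-bounded : ∀ n w → Reduced w → length w ≤ n → ∀ s → Dec (Head s w)
  head?-bounded n       []      red l       s = no λ { (_ , _ , ()) }
  head?-bounded (suc n) (t ∷ w) red (s≤s l) s = Decide.head?-step n (head?-bounded n) t w red l s

  head? : ∀ {w} → Reduced w → ∀ s → Dec (Head s w)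
  head? {w} red = head?-bounded (length w) w red ℕₚ.≤-refl

  infix 4 _≈?_

  abstract
    normalForm : ∀ w → Σ Word λ r → r ≈ w × Reduced r
    normalForm []      = [] , ≈-refl , λ _ _ → z≤n
    normalForm (s ∷ w) with normalForm w
    ... | r , e , red with head? red s
    ...   | yes h@(r′ , e′ , _) = r′ , ≈-trans (flip-∷ e′) (∷-cong s e) , Head-Reduced red h
    ...   | no ¬h               = s ∷ r , ∷-cong s e , ¬Head⇒Reduced red ¬h

    ≈[]? : ∀ w → Dec (w ≈ [])
    ≈[]? w with normalForm w
    ... | []    , e , red = yes (≈-sym e)
    ... | s ∷ r , e , red = no λ f → contradiction (red [] (≈-trans (≈-sym f) (≈-sym e))) λ ()

    _≈?_ : ∀ x y → Dec (x ≈ y)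
    x ≈? y with ≈[]? (x ++ reverse y)
    ... | yes e = yes (∙-cancelʳ (reverse y) x y (≈-trans e (≈-sym (inverseʳ y))))
    ... | no ¬e = no λ f → ¬e (≈-trans (++-congʳ (reverse y) f) (inverseʳ y))

-- Length, the reflection cocycle and strong exchange.

module Bruhat (C : CoxeterMatrix) where
  open Basics C
  open Reflections C
  open Descents C
  open Mod2 W-setoid

  ℓ : Word → ℕ
  ℓ w = length (proj₁ (normalForm w))

  ℓ-minimal : ∀ {b w} → b ≈ w → ℓ w ≤ length b
  ℓ-minimal {b} {w} e with normalForm w
  ... | r , f , red = red b (≈-trans e (≈-sym f))

  ℓ-cong : ∀ {x y} → x ≈ y → ℓ x ≡ ℓ y
  ℓ-cong {x} {y} e = ℕₚ.≤-antisym
    (ℓ-minimal (≈-trans (proj₁ (proj₂ (normalForm y))) (≈-sym e)))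
    (ℓ-minimal (≈-trans (proj₁ (proj₂ (normalForm x))) e))

  Reduced⇒ℓ : ∀ {r} → Reduced r → length r ≡ ℓ r
  Reduced⇒ℓ {r} red = ℕₚ.≤-antisym (red _ (proj₁ (proj₂ (normalForm r)))) (ℓ-minimal {r} ≈-refl)

  ℓ-of : ∀ {r w} → Reduced r → r ≈ w → ℓ w ≡ length r
  ℓ-of red e = ≡.trans (≡.sym (ℓ-cong e)) (≡.sym (Reduced⇒ℓ red))

  LenLt⇒< : ∀ {u w} → LenLt u w → ℓ u < ℓ w
  LenLt⇒< {u} {w} (a , e , a<) = ℕₚ.≤-<-trans (ℓ-minimal e) (a< _ (proj₁ (proj₂ (normalForm w))))

  <⇒LenLt : ∀ {u w} → ℓ u < ℓ w → LenLt u w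
  <⇒LenLt {u} l = _ , proj₁ (proj₂ (normalForm u)) , λ b e → ℕₚ.<-≤-trans l (ℓ-minimal e)

  ℓ-∷ : ∀ s w → ℓ (s ∷ w) ≡ suc (ℓ w) ⊎ ℓ w ≡ suc (ℓ (s ∷ w))
  ℓ-∷ s w = decide (proj₂ (normalForm w)) (head? (proj₂ (proj₂ (normalForm w))) s)
    where
    decide : ∀ {r} → r ≈ w × Reduced r → Dec (Head s r) → ℓ (s ∷ w) ≡ suc (length r) ⊎ length r ≡ suc (ℓ (s ∷ w))
    decide (e , red) (yes h@(r′ , e′ , l)) = inj₂ (≡.trans l (cong suc (≡.sym (ℓ-of (Head-Reduced red h) (≈-trans (flip-∷ e′) (∷-cong s e))))))
    decide (e , red) (no ¬h)               = inj₁ (ℓ-of (¬Head⇒Reduced red ¬h) (∷-cong s e))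

  odd : Word → List Word → Bool
  odd t []       = false
  odd t (x ∷ xs) = does (t ≈? x) xor odd t xs

  does-cong : ∀ {t t′ x x′} → t ≈ t′ → x ≈ x′ → does (t ≈? x) ≡ does (t′ ≈? x′)
  does-cong {t} {t′} {x} {x′} e f = does-⇔ (mk⇔ (λ g → ≈-trans (≈-sym e) (≈-trans g f))
                                               (λ g → ≈-trans e (≈-trans g (≈-sym f)))) (t ≈? x) (t′ ≈? x′)

  xor-swap : ∀ a b c → a xor (b xor c) ≡ b xor (a xor c)
  xor-swap a b c = ≡.trans (≡.sym (Boolₚ.xor-assoc a b c)) (≡.trans (cong (_xor c) (Boolₚ.xor-comm a b)) (Boolₚ.xor-assoc b a c))

  xor-cancel : ∀ a b → a xor (a xor b) ≡ b
  xor-cancel false b = refl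
  xor-cancel true  b = Boolₚ.not-involutive b

  odd-cong : ∀ {t t′} xs → t ≈ t′ → odd t xs ≡ odd t′ xs
  odd-cong []       e = refl
  odd-cong (x ∷ xs) e = cong₂ _xor_ (does-cong e ≈-refl) (odd-cong xs e)

  odd-Pointwise : ∀ {t xs ys} → Pointwise _≈_ xs ys → odd t xs ≡ odd t ys
  odd-Pointwise []       = refl
  odd-Pointwise (e ∷ es) = cong₂ _xor_ (does-cong ≈-refl e) (odd-Pointwise es)

  odd-↭ : ∀ {t xs ys} → xs ↭ ys → odd t xs ≡ odd t ys
  odd-↭ (refl es)    = odd-Pointwise es
  odd-↭ (prep e p)   = cong₂ _xor_ (does-cong ≈-refl e) (odd-↭ p)
  odd-↭ {t} (swap {ys = ys} e e′ p) = ≡.trans (cong₂ _xor_ (does-cong ≈-refl e) (cong₂ _xor_ (does-cong ≈-refl e′) (odd-↭ p)))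
                                    (xor-swap (does (t ≈? _)) (does (t ≈? _)) (odd t ys))
  odd-↭ (trans p q)  = ≡.trans (odd-↭ p) (odd-↭ q)

  odd-++ : ∀ t xs ys → odd t (xs ++ ys) ≡ odd t xs xor odd t ys
  odd-++ t []       ys = refl
  odd-++ t (x ∷ xs) ys = ≡.trans (cong (does (t ≈? x) xor_) (odd-++ t xs ys)) (≡.sym (Boolₚ.xor-assoc (does (t ≈? x)) (odd t xs) (odd t ys)))

  odd-++-dbl : ∀ t xs P → odd t (xs ++ dbl P) ≡ odd t xs
  odd-++-dbl t xs P = ≡.trans (odd-++ t xs (dbl P)) (≡.trans (cong (odd t xs xor_) (odd-dbl P)) (Boolₚ.xor-identityʳ (odd t xs)))
    where
    odd-dbl : ∀ P → odd t (dbl P) ≡ false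
    odd-dbl []      = refl
    odd-dbl (p ∷ P) = ≡.trans (xor-cancel (does (t ≈? p)) (odd t (dbl P))) (odd-dbl P)

  odd-∼ : ∀ {t xs ys} → xs ∼ ys → odd t xs ≡ odd t ys
  odd-∼ {t} {xs} {ys} (P , Q , p) = ≡.trans (≡.sym (odd-++-dbl t xs P)) (≡.trans (odd-↭ p) (odd-++-dbl t ys Q))

  odd⇒∈ : ∀ {t} xs → odd t xs ≡ true → t ∈ xs
  odd⇒∈ {t} (x ∷ xs) e with t ≈? x
  ... | yes p = here p
  ... | no  _ = there (odd⇒∈ xs e)

  -- The parity with which `t` occurs among the reflections of `w`; by `N-resp-∼` it depends on the
  -- group element only. Decidable equality now permits a Boolean value.
  χ : Word → Word → Bool
  χ t w = odd t (N w)

  χ-cong : ∀ {t t′ w w′} → t ≈ t′ → w ≈ w′ → χ t w ≡ χ t′ w′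
  χ-cong {w = w} e f = ≡.trans (odd-cong (N w) e) (odd-∼ (N-resp-∼ f))

  conjs-cong : ∀ x {u v} → u ≈ v → conjs x u ≈ conjs x v
  conjs-cong []      e = e
  conjs-cong (s ∷ x) e = conj-cong s (conjs-cong x e)

  conjs-injective : ∀ x {u v} → conjs x u ≈ conjs x v → u ≈ v
  conjs-injective x {u} {v} e = ∙-cancelˡ x u v (≈-trans (≈-sym (conjs-++ x u)) (≈-trans (++-congʳ x e) (conjs-++ x v)))

  -- The cocycle identity: the reflections of `y` enter conjugated by `x`, and conjugation is
  -- injective.
  χ-++ : ∀ {t t′} x y → t ≈ conjs x t′ → χ t (x ++ y) ≡ χ t x xor χ t′ y
  χ-++ {t} {t′} x y e rewrite N-++ x y = ≡.trans (odd-++ t (N x) (map (conjs x) (N y))) (cong (χ t x xor_) (go (N y)))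
    where
    go : ∀ ys → odd t (map (conjs x) ys) ≡ odd t′ ys
    go []       = refl
    go (y ∷ ys) = cong₂ _xor_ (does-⇔ (mk⇔ (λ f → conjs-injective x (≈-trans (≈-sym e) f))
                                            (λ f → ≈-trans e (conjs-cong x f))) (t ≈? conjs x y) (t′ ≈? y)) (go ys)

  conjs-reverse : ∀ x u → conjs x u ≈ (x ++ u ++ reverse x)
  conjs-reverse x u = ∙-cancelʳ x _ _ (≈-trans (conjs-++ x u) (≈-sym (≈-trans
    (≈-reflexive (≡.trans (Listₚ.++-assoc x (u ++ reverse x) x) (cong (x ++_) (Listₚ.++-assoc u (reverse x) x))))
    (++-congˡ x (≈-trans (++-congˡ u (inverseˡ x)) (≈-reflexive (Listₚ.++-identityʳ u)))))))

  -- In the expansion along v s v⁻¹ the contributions of v and v⁻¹ cancel, since together they give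
  -- the parity for the identity; the middle letter leaves one.
  χ-self : ∀ {t} → IsReflection t → χ t t ≡ true
  χ-self {t} (v , s , e) = begin
    χ t t                                         ≡⟨ χ-cong ≈-refl e ⟩
    χ t (v ++ s ∷ reverse v)                      ≡⟨ χ-++ v (s ∷ reverse v) t≈ ⟩
    χ t v xor χ [ s ] (s ∷ reverse v)             ≡⟨ cong (χ t v xor_) (χ-++ [ s ] (reverse v) (≈-sym (ss≈ s [ s ]))) ⟩
    χ t v xor (χ [ s ] [ s ] xor χ [ s ] (reverse v)) ≡⟨ cong (λ b → χ t v xor ((b xor false) xor χ [ s ] (reverse v))) (dec-true ([ s ] ≈? [ s ]) ≈-refl) ⟩
    χ t v xor not (χ [ s ] (reverse v))           ≡⟨ flip (χ t v) (χ [ s ] (reverse v)) (≡.trans (≡.sym (χ-++ v (reverse v) t≈)) (χ-cong ≈-refl (inverseʳ v))) ⟩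
    true                                          ∎
    where
    open ≡-Reasoning
    t≈ : t ≈ conjs v [ s ]
    t≈ = ≈-trans e (≈-sym (conjs-reverse v [ s ]))
    flip : ∀ a b → a xor b ≡ false → a xor not b ≡ true
    flip false false _ = refl
    flip true  true  _ = refl

  χ-reflect : ∀ {t} → IsReflection t → ∀ w → χ t (t ++ w) ≡ not (χ t w)
  χ-reflect {t} r w = ≡.trans (χ-++ t w (≈-sym (∙-cancelʳ t _ _ (conjs-++ t t)))) (cong (_xor χ t w) (χ-self r))

  reflection-involutive : ∀ {t} → IsReflection t → ∀ x → (t ++ t ++ x) ≈ x
  reflection-involutive {t} (v , s , e) x = ≈-trans (≈-reflexive (≡.sym (Listₚ.++-assoc t t x))) (++-congʳ x tt≈)
    where
    t≈ : t ≈ conjs v [ s ]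
    t≈ = ≈-trans e (≈-sym (conjs-reverse v [ s ]))
    tv≈ : (t ++ v) ≈ (v ++ [ s ])
    tv≈ = ≈-trans (++-congʳ v t≈) (conjs-++ v [ s ])
    tt≈ : (t ++ t) ≈ []
    tt≈ = ∙-cancelʳ v _ _ (≈-trans (≈-reflexive (Listₚ.++-assoc t t v)) (≈-trans (++-congˡ t tv≈)
      (≈-trans (≈-reflexive (≡.sym (Listₚ.++-assoc t v [ s ]))) (≈-trans (++-congʳ [ s ] tv≈)
      (≈-trans (≈-reflexive (Listₚ.++-assoc v [ s ] [ s ])) (≈-trans (++-congˡ v (ss≈ s [])) (≈-reflexive (Listₚ.++-identityʳ v))))))))

  -- If `t` is odd in `b`, it deletes a letter of `b`. Otherwise `χ-reflect` makes it odd in a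
  -- reduced word of `x`, and deleting there makes `y` shorter than `x`. The word `b` may be
  -- non-reduced, as `below⇒subword` requires.
  strongExchange : ∀ {t x y b} → IsReflection t → y ≈ (t ++ x) → ℓ x < ℓ y → b ≈ y →
                   Σ Word λ b′ → Del b′ b × x ≈ b′
  strongExchange {t} {x} {y} {b} r e l f with χ t b in eq
  ... | true with ∈-N⇒Del b (odd⇒∈ (N b) eq)
  ...   | b′ , d , g = b′ , d , ≈-trans (≈-sym (reflection-involutive r x)) (≈-trans (++-congˡ t (≈-trans (≈-sym e) (≈-sym f))) g)
  strongExchange {t} {x} {y} {b} r e l f | false with normalForm x
  ... | a , a≈x , _ with ∈-N⇒Del a (odd⇒∈ (N a) χ≡true)
    where
    χ≡true : χ t a ≡ true
    χ≡true = Boolₚ.not-injective (≡.trans (≡.sym (χ-reflect r a))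
      (≡.trans (χ-cong ≈-refl (≈-trans (++-congˡ t a≈x) (≈-sym (≈-trans f e)))) eq))
  ...   | a′ , d , g = contradiction
            (ℕₚ.≤-trans (ℓ-minimal (≈-trans (≈-sym g) (≈-trans (++-congˡ t a≈x) (≈-sym e)))) (ℕₚ.n≤1+n _))
            (ℕₚ.<⇒≱ (ℕₚ.≤-<-trans (ℕₚ.≤-reflexive (≡.sym (Del-length d))) l))

  [s]-reflection : ∀ s → IsReflection [ s ]
  [s]-reflection s = [] , s , ≈-refl

  conj-reflection : ∀ s {t} → IsReflection t → IsReflection (conj s t)
  conj-reflection s {t} (v , r , e) = s ∷ v , r , ≈-trans (conj-cong s e) (≈-reflexive (cong (s ∷_) (begin
    (v ++ r ∷ reverse v) ++ [ s ]    ≡⟨ Listₚ.++-assoc v (r ∷ reverse v) [ s ] ⟩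
    v ++ r ∷ reverse v ++ [ s ]      ≡⟨ cong (λ x → v ++ r ∷ x) (≡.sym (Listₚ.unfold-reverse s v)) ⟩
    v ++ r ∷ reverse (s ∷ v)         ∎)))
    where open ≡-Reasoning

  conjs-reflection : ∀ x {t} → IsReflection t → IsReflection (conjs x t)
  conjs-reflection []      r = r
  conjs-reflection (s ∷ x) r = conj-reflection s (conjs-reflection x r)

  -- Bruhat steps multiply on the right, whereas `N` speaks of left multiplication; tx = x(x⁻¹tx)
  -- translates.
  leftStep : ∀ {t x y} → IsReflection t → y ≈ (t ++ x) → ℓ x < ℓ y → x ≤B y
  leftStep {t} {x} {y} r e l = ≤B-step (conjs (reverse x) t) (conjs-reflection (reverse x) r)
    (≈-trans e (≈-sym (∙-cancelʳ (reverse x) _ _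
      (≈-trans (≈-reflexive (Listₚ.++-assoc x _ (reverse x)))
      (≈-trans (++-congˡ x (conjs-++ (reverse x) t))
      (≈-trans (≈-reflexive (≡.sym (Listₚ.++-assoc x (reverse x) t)))
      (≈-trans (++-congʳ t (inverseʳ x))
      (≈-sym (≈-trans (≈-reflexive (Listₚ.++-assoc t x (reverse x))) (≈-trans (++-congˡ t (inverseʳ x)) (≈-reflexive (Listₚ.++-identityʳ t))))))))))))
    (<⇒LenLt l)

  rightToLeft : ∀ {t x y} → y ≈ (x ++ t) → y ≈ (conjs x t ++ x)
  rightToLeft {t} {x} e = ≈-trans e (≈-sym (conjs-++ x t))

  -- Descents, the lifting property and the adjunction.

  Des⇒ℓ : ∀ {s w} → Des s w → ℓ w ≡ suc (ℓ (s ∷ w))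
  Des⇒ℓ {s} {w} d with ℓ-∷ s w
  ... | inj₂ e = e
  ... | inj₁ e = contradiction (LenLt⇒< d) (ℕₚ.<⇒≯ (ℕₚ.≤-reflexive (≡.sym e)))

  ¬Des⇒ℓ : ∀ {s w} → ¬ Des s w → ℓ (s ∷ w) ≡ suc (ℓ w)
  ¬Des⇒ℓ {s} {w} ¬d with ℓ-∷ s w
  ... | inj₁ e = e
  ... | inj₂ e = contradiction (<⇒LenLt (ℕₚ.≤-reflexive (≡.sym e))) ¬d

  des? : ∀ s w → Dec (Des s w)
  des? s w with ℓ (s ∷ w) ℕ.<? ℓ w
  ... | yes l = yes (<⇒LenLt l)
  ... | no ¬l = no λ d → ¬l (LenLt⇒< d)

  Des-resp : ∀ {s x y} → x ≈ y → Des s x → Des s y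
  Des-resp {s} e (a , f , a<) = a , ≈-trans f (∷-cong s e) , λ b g → a< b (≈-trans g (≈-sym e))

  Des-flip : ∀ {s w} → ¬ Des s w → Des s (s ∷ w)
  Des-flip {s} {w} ¬d = <⇒LenLt (≡.subst₂ _<_ (≡.sym (ℓ-cong (ss≈ s w))) (≡.sym (¬Des⇒ℓ ¬d)) (ℕₚ.n<1+n _))

  ¬Des-flip : ∀ {s w} → Des s w → ¬ Des s (s ∷ w)
  ¬Des-flip {s} {w} d d′ = ℕₚ.<-asym (LenLt⇒< d) (≡.subst (_< ℓ (s ∷ w)) (ℓ-cong (ss≈ s w)) (LenLt⇒< d′))

  ≤B-refl : ∀ {x} → x ≤B x
  ≤B-refl = ≤B-eq ≈-refl

  up : ∀ {s w} → ¬ Des s w → w ≤B (s ∷ w)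
  up {s} ¬d = leftStep ([s]-reflection s) ≈-refl (ℕₚ.≤-reflexive (≡.sym (¬Des⇒ℓ ¬d)))

  down : ∀ {s w} → Des s w → (s ∷ w) ≤B w
  down {s} {w} d = leftStep ([s]-reflection s) (≈-sym (ss≈ s w)) (LenLt⇒< d)

  -- π₁ s and τ₁ s send w to the smaller and to the larger one of w and sw.
  π₁ τ₁ : S → Word → Word
  π₁ s w with des? s w
  ... | yes _ = s ∷ w
  ... | no  _ = w
  τ₁ s w with des? s w
  ... | yes _ = w
  ... | no  _ = s ∷ w

  π₁≤ : ∀ s w → π₁ s w ≤B w
  π₁≤ s w with des? s w
  ... | yes d = down d
  ... | no  _ = ≤B-refl

  π₁≤∷ : ∀ s w → π₁ s w ≤B (s ∷ w)
  π₁≤∷ s w with des? s w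
  ... | yes _ = ≤B-refl
  ... | no ¬d = up ¬d

  ≤τ₁ : ∀ s w → w ≤B τ₁ s w
  ≤τ₁ s w with des? s w
  ... | yes _ = ≤B-refl
  ... | no ¬d = up ¬d

  ∷≤τ₁ : ∀ s w → (s ∷ w) ≤B τ₁ s w
  ∷≤τ₁ s w with des? s w
  ... | yes d = down d
  ... | no  _ = ≤B-refl

  -- This is the unit of the adjunction between `π₁ s` and `τ₁ s`; `π₁τ₁≤` is its counit.
  ≤τ₁π₁ : ∀ s w → w ≤B τ₁ s (π₁ s w)
  ≤τ₁π₁ s w with des? s w
  ... | no  _ = ≤τ₁ s w
  ... | yes d with des? s (s ∷ w)
  ...   | yes d′ = contradiction d′ (¬Des-flip d)
  ...   | no  _  = ≤B-eq (≈-sym (ss≈ s w))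

  π₁τ₁≤ : ∀ s w → π₁ s (τ₁ s w) ≤B w
  π₁τ₁≤ s w with des? s w
  ... | yes _ = π₁≤ s w
  ... | no ¬d with des? s (s ∷ w)
  ...   | yes _  = ≤B-eq (ss≈ s w)
  ...   | no ¬d′ = contradiction (Des-flip ¬d) ¬d′

  module Lifting {t x y} (s : S) (r : IsReflection t) (e : y ≈ (t ++ x)) (l : ℓ x < ℓ y) where

    conjugate : ℓ (s ∷ x) < ℓ (s ∷ y) → (s ∷ x) ≤B (s ∷ y)
    conjugate = leftStep (conj-reflection s r) (≈-trans (∷-cong s e) (≈-sym (conj-++ s t x)))

    -- Strong exchange is applied to `s ∷ b` with `b` reduced for sy. Deleting `s` gives x = sy;
    -- deleting a letter of `b` makes sx shorter than sy, and the conjugated reflection relates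
    -- these two.
    crossing : ¬ Des s x → Des s y → x ≈ (s ∷ y) ⊎ (s ∷ x) ≤B (s ∷ y)
    crossing ¬dx dy with normalForm (s ∷ y)
    ... | b , f , red with strongExchange {b = s ∷ b} r e l (≈-sym (flip-∷ (≈-sym f)))
    ...   | _      , here    , g = inj₁ (≈-trans g f)
    ...   | _ ∷ b′ , there d , g = inj₂ (conjugate (ℕₚ.≤-<-trans (ℓ-minimal (≈-sym (≈-trans (∷-cong s g) (ss≈ s b′))))
            (ℕₚ.≤-reflexive (≡.trans (≡.sym (Del-length d)) (≡.sym (ℓ-of red f))))))

    π₁-mono : π₁ s x ≤B π₁ s y
    π₁-mono with des? s x | des? s y
    ... | yes dx | yes dy = conjugate (ℕₚ.≤-pred (≡.subst₂ _<_ (Des⇒ℓ dx) (Des⇒ℓ dy) l))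
    ... | yes dx | no  _  = ≤B-trans (down dx) (leftStep r e l)
    ... | no  _  | no  _  = leftStep r e l
    ... | no ¬dx | yes dy with crossing ¬dx dy
    ...   | inj₁ f = ≤B-eq f
    ...   | inj₂ p = ≤B-trans (up ¬dx) p

    τ₁-mono : τ₁ s x ≤B τ₁ s y
    τ₁-mono with des? s x | des? s y
    ... | yes _  | yes _  = leftStep r e l
    ... | yes _  | no ¬dy = ≤B-trans (leftStep r e l) (up ¬dy)
    ... | no ¬dx | no ¬dy = conjugate (≡.subst₂ _<_ (≡.sym (¬Des⇒ℓ ¬dx)) (≡.sym (¬Des⇒ℓ ¬dy)) (s≤s l))
    ... | no ¬dx | yes dy with crossing ¬dx dy
    ...   | inj₁ f = ≤B-eq (≈-sym (flip-∷ (≈-sym f)))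
    ...   | inj₂ p = ≤B-trans p (down dy)

  π₁-mono : ∀ s {x y} → x ≤B y → π₁ s x ≤B π₁ s y
  π₁-mono s (≤B-trans p q) = ≤B-trans (π₁-mono s p) (π₁-mono s q)
  π₁-mono s (≤B-step {x} t r e l) = Lifting.π₁-mono s (conjs-reflection x r) (rightToLeft {t} {x} e) (LenLt⇒< l)
  π₁-mono s {x} {y} (≤B-eq e) with des? s x | des? s y
  ... | yes _ | yes _ = ≤B-eq (∷-cong s e)
  ... | yes d | no ¬d = contradiction (Des-resp e d) ¬d
  ... | no ¬d | yes d = contradiction (Des-resp (≈-sym e) d) ¬d
  ... | no _  | no _  = ≤B-eq e

  τ₁-mono : ∀ s {x y} → x ≤B y → τ₁ s x ≤B τ₁ s y
  τ₁-mono s (≤B-trans p q) = ≤B-trans (τ₁-mono s p) (τ₁-mono s q)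
  τ₁-mono s (≤B-step {x} t r e l) = Lifting.τ₁-mono s (conjs-reflection x r) (rightToLeft {t} {x} e) (LenLt⇒< l)
  τ₁-mono s {x} {y} (≤B-eq e) with des? s x | des? s y
  ... | yes _ | yes _ = ≤B-eq e
  ... | yes d | no ¬d = contradiction (Des-resp e d) ¬d
  ... | no ¬d | yes d = contradiction (Des-resp (≈-sym e) d) ¬d
  ... | no _  | no _  = ≤B-eq (∷-cong s e)

  πW τW : Word → Word → Word
  πW []      x = x
  πW (s ∷ r) x = π₁ s (πW r x)
  τW []      p = p
  τW (s ∷ r) p = τW r (τ₁ s p)

  πW-mono : ∀ r {x y} → x ≤B y → πW r x ≤B πW r y
  πW-mono []      p = p
  πW-mono (s ∷ r) p = π₁-mono s (πW-mono r p)

  -- Adjoints of a composite compose in the opposite order, which is why `τW` consumes the first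
  -- letter first.
  adjoint⇒ : ∀ r {x p} → πW r x ≤B p → x ≤B τW r p
  adjoint⇒ []      h = h
  adjoint⇒ (s ∷ r) h = adjoint⇒ r (≤B-trans (≤τ₁π₁ s _) (τ₁-mono s h))

  adjoint⇐ : ∀ r {x p} → x ≤B τW r p → πW r x ≤B p
  adjoint⇐ []      h = h
  adjoint⇐ (s ∷ r) {p = p} h = ≤B-trans (π₁-mono s (adjoint⇐ r h)) (π₁τ₁≤ s p)

  PiS-π₁ : ∀ s w → PiS s w (π₁ s w)
  PiS-π₁ s w with des? s w
  ... | yes d = inj₁ (d , ≈-refl)
  ... | no ¬d = inj₂ (¬d , ≈-refl)

  PiS⇒≈π₁ : ∀ {s w v} → PiS s w v → v ≈ π₁ s w
  PiS⇒≈π₁ {s} {w} h with des? s w | h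
  ... | yes _ | inj₁ (_ , e) = e
  ... | yes d | inj₂ (¬d , _) = contradiction d ¬d
  ... | no ¬d | inj₁ (d , _) = contradiction d ¬d
  ... | no _  | inj₂ (_ , e) = e

  PiWord-πW : ∀ r x → PiWord r x (πW r x)
  PiWord-πW []      x = ≈-refl
  PiWord-πW (s ∷ r) x = πW r x , PiWord-πW r x , PiS-π₁ s (πW r x)

  πW≤PiWord : ∀ r {x v} → PiWord r x v → πW r x ≤B v
  πW≤PiWord []      e           = ≤B-eq (≈-sym e)
  πW≤PiWord (s ∷ r) (y , h , h′) = ≤B-trans (π₁-mono s (πW≤PiWord r h)) (≤B-eq (≈-sym (PiS⇒≈π₁ h′)))

  -- The subword property and independence of the reduced word.

  Del⇒⊑ : ∀ {w′ w} → Del w′ w → w′ ⊑ w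
  Del⇒⊑ (here {s})  = s ∷ʳ ⊆-refl
  Del⇒⊑ (there d) = refl ∷ Del⇒⊑ d

  -- Each Bruhat step deletes one letter. Chains compose because the word reached after a deletion
  -- may be non-reduced.
  below⇒subword : ∀ {x y} → x ≤B y → ∀ b → b ≈ y → Σ Word λ v → v ⊑ b × v ≈ x
  below⇒subword (≤B-eq e) b f = b , ⊆-refl , ≈-trans f (≈-sym e)
  below⇒subword (≤B-step {x} t r e l) b f with strongExchange (conjs-reflection x r) (rightToLeft {t} {x} e) (LenLt⇒< l) f
  ... | v , d , g = v , Del⇒⊑ d , ≈-sym g
  below⇒subword (≤B-trans p q) b f with below⇒subword q b f
  ... | v , v⊑b , g with below⇒subword p v g
  ...   | v′ , v′⊑v , h = v′ , ⊆-trans v′⊑v v⊑b , h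

  τ₁-Reduced : ∀ {s r} → Reduced (s ∷ r) → τ₁ s r ≤B (s ∷ r)
  τ₁-Reduced {s} {r} red with des? s r
  ... | no  _ = ≤B-refl
  ... | yes d = contradiction (LenLt⇒< d)
                  (ℕₚ.<⇒≯ (≡.subst₂ _<_ (Reduced⇒ℓ (Reduced-tail red)) (Reduced⇒ℓ red) (ℕₚ.n<1+n _)))

  -- Every letter of a reduced word is an ascent of the rest, so prepending it to the rest is
  -- `τ₁ s`, which is monotone and lies above both v and sv.
  subword⇒below : ∀ {r v} → Reduced r → v ⊑ r → v ≤B r
  subword⇒below red [] = ≤B-refl
  subword⇒below {s ∷ r} red (.s ∷ʳ p) =
    ≤B-trans (subword⇒below (Reduced-tail red) p) (≤B-trans (≤τ₁ s r) (τ₁-Reduced red))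
  subword⇒below {s ∷ r} {.s ∷ v} red (refl ∷ p) =
    ≤B-trans (∷≤τ₁ s v) (≤B-trans (τ₁-mono s (subword⇒below (Reduced-tail red) p)) (τ₁-Reduced red))

  -- With the next lemma, πW r x = min { v x : v a subword of r }.
  πW≤subword : ∀ {r v} x → v ⊑ r → πW r x ≤B (v ++ x)
  πW≤subword x [] = ≤B-refl
  πW≤subword {s ∷ r} x (.s ∷ʳ p) = ≤B-trans (π₁≤ s (πW r x)) (πW≤subword x p)
  πW≤subword {s ∷ r} {.s ∷ v} x (refl ∷ p) = ≤B-trans (π₁-mono s (πW≤subword x p)) (π₁≤∷ s (v ++ x))

  πW-subword : ∀ r x → Σ Word λ v → v ⊑ r × πW r x ≈ (v ++ x)
  πW-subword []      x = [] , [] , ≈-refl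
  πW-subword (s ∷ r) x with πW-subword r x | des? s (πW r x)
  ... | v , p , e | yes _ = s ∷ v , refl ∷ p , ∷-cong s e
  ... | v , p , e | no  _ = v , s ∷ʳ p , e

  -- The subword of `r` attaining the minimum lies below `r`, hence is represented by a subword of
  -- `r′`, which competes in the minimum for `r′`.
  πW-independent : ∀ {r r′} → Reduced r → r ≈ r′ → ∀ x → πW r′ x ≤B πW r x
  πW-independent {r} {r′} red e x with πW-subword r x
  ... | v , p , f with below⇒subword (≤B-trans (subword⇒below red p) (≤B-eq e)) r′ ≈-refl
  ...   | v′ , p′ , g = ≤B-trans (πW≤subword x p′) (≤B-eq (≈-trans (++-congʳ x g) (≈-sym f)))

  -- Bruhat filters generated by images under `π`.

  ∇π-Mac : ∀ F → InMac F → ∀ u → InMac (∇ (π u F))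
  ∇π-Mac F (_ , _ , UL⊆F) u =
    (λ { x y x≤y (v , h , v≤x) → v , h , ≤B-trans v≤x x≤y }) , (λ w h x q → q w h) , closed
    where
    r : Word
    r = proj₁ (normalForm u)
    r≈u : r ≈ u
    r≈u = proj₁ (proj₂ (normalForm u))
    red : Reduced r
    red = proj₂ (proj₂ (normalForm u))
    closed : U (L (∇ (π u F))) ⊆ ∇ (π u F)
    closed p p∈ = πW r (τW r p)
                , (r , red , r≈u , τW r p , UL⊆F (τW r p) τ∈ , PiWord-πW r (τW r p))
                , adjoint⇐ r ≤B-refl
      where
      π-lower : ∀ q → L F q → L (∇ (π u F)) (πW r q)
      π-lower q q≤ w (v , (r′ , red′ , r′≈u , x , x∈F , h) , v≤w) =
        ≤B-trans (πW-mono r (q≤ x x∈F))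
        -- A member of `π u F` may come from any reduced word `r′` of `u`; this passes from it to
        -- the fixed `r`.
        (≤B-trans (πW-independent red′ (≈-trans r′≈u (≈-sym r≈u)) x)
        (≤B-trans (πW≤PiWord r′ h) v≤w))
      τ∈ : U (L F) (τW r p)
      τ∈ q q≤ = adjoint⇒ r (p∈ (πW r q) (π-lower q q≤))

  ∇π∇ : ∀ u Y → ∇ (π u (∇ Y)) ≐ ∇ (π u Y)
  ∇π∇ u Y = to , from
    where
    to : ∇ (π u (∇ Y)) ⊆ ∇ (π u Y)
    to w (v , (r , red , r≈u , x , (y , y∈Y , y≤x) , h) , v≤w) =
      πW r y , (r , red , r≈u , y , y∈Y , PiWord-πW r y) , ≤B-trans (πW-mono r y≤x) (≤B-trans (πW≤PiWord r h) v≤w)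
    from : ∇ (π u Y) ⊆ ∇ (π u (∇ Y))
    from w (v , (r , red , r≈u , x , x∈Y , h) , v≤w) = v , (r , red , r≈u , x , (x , x∈Y , ≤B-refl) , h) , v≤w

theorem1p1 : (C : CoxeterMatrix) → (F : Coxeter.Subset C) → Coxeter.InMac C F →
    (u : Coxeter.Word C) →
    Coxeter.InMac C (Coxeter.∇ C (Coxeter.π C u F))
    × ((Y : Coxeter.Subset C) → Coxeter.RespectsW C Y →
       Coxeter._≐_ C (Coxeter.∇ C (Coxeter.π C u (Coxeter.∇ C Y))) (Coxeter.∇ C (Coxeter.π C u Y)))
theorem1p1 C F F∈Mac u = Bruhat.∇π-Mac C F F∈Mac u , λ Y _ → Bruhat.∇π∇ C u Y
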